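{- Let $k$ and $n$ be positive integers. For $m\in\{0,1,2\}$, we have $$(-1)^{k-1}\left(C_m(n)-\sum_{j=-k}^{k}(-1)^j\,u_m\big(n-j(3j-1)/2\big)\right)=\sum_{j=0}^{n}C_m(j)\,\widetilde{P}_k(n-j).$$
   Context: Unimodal compositions. A composition of a positive integer $n$ is a sequence $(\lambda_1,\ldots,\lambda_r)$ of positive integers (parts) with sum $n$. It is unimodal if there exists $t\in\{1,\ldots,r\}$ with $\lambda_1\leqslant\cdots\leqslant\lambda_t$ and $\lambda_t\geqslant\cdots\geqslant\lambda_r$. For $n\geqslant 1$, $u_0(n)$ is the number of unimodal compositions of $n$, and $u_0(0)=0$. For $m\geqslant1$ and $n\geqslant0$, $u_m(n)$ is the number of unimodal compositions of $n+m$ in which the maximal part appears exactly $m$ times; in particular $u_m(0)=1$. Convention: $u_m(n)=0$ for $n<0$. Crank. For a partition $\lambda=(\lambda_1\geqslant\lambda_2\geqslant\cdots)$, let $\omega(\lambda)$ be the number of parts of $\lambda$ equal to $1$, and $\mu(\lambda)$ the number of parts of $\lambda$ larger than $\omega(\lambda)$. The crank is $c(\lambda)=\lambda_1$ (the largest part) if $\omega(\lambda)=0$, and $c(\lambda)=\mu(\lambda)-\omega(\lambda)$ if $\omega(\lambda)>0$. The empty partition of $0$ has crank $0$. For a non-negative integer $n\neq1$: $C_0(n)$ is the number of partitions $\lambda$ of $n$ with $c(\lambda)>0$; $C_1(n)$ is the number of partitions $\lambda$ of $n$ with $c(\lambda)\geqslant0$; $C_2(n)$ is the number of partitions $\lambda$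 of $n$ with $c(\lambda)=0$. Thus $C_0(0)=0$ and $C_1(0)=C_2(0)=1$. Moreover, by definition, $C_0(1)=1$, $C_1(1)=0$, $C_2(1)=-1$. $\widetilde{P}_k(n)$ (for $k\geqslant 1$, $n\geqslant 0$) is the number of partitions of $n$ in which every integer $1,2,\ldots,k$ appears as a part at least once, and the first part larger than $k$ (i.e. the smallest part among the parts exceeding $k$, which is required to exist) appears at least $k+1$ times; in particular $\widetilde{P}_k(0)=0$. -}

module Defs where

open import Data.Empty using (⊥)
open import Data.Fin using (Fin; toℕ)
open import Data.Fin.Patterns using (0F; 1F; 2F)
import Data.Fin.Properties as Fin
open import Data.Integer as ℤ using (ℤ; +_; -[1+_]; 0ℤ; 1ℤ; -1ℤ; ∣_∣)
import Data.Integer.Properties as ℤ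
open import Data.List using (List; []; _∷_; concatMap; drop; filter; foldr; length; map; take; upTo)
open import Data.List.Extrema.Nat using (max)
open import Data.List.Membership.DecPropositional using (_∈?_)
open import Data.List.Membership.Propositional using (_∈_)
open import Data.List.Membership.Propositional.Properties using (∈-concatMap⁺; ∈-concatMap⁻)
open import Data.List.Relation.Binary.Disjoint.Propositional using (Disjoint)
open import Data.List.Relation.Unary.All as All using (All; []; _∷_; all?)
open import Data.List.Relation.Unary.AllPairs using ([]; _∷_)
open import Data.List.Relation.Unary.Any as Any using (Any; here; there; any?)
open import Data.List.Relation.Unary.Linked using (Linked; linked?)
open import Data.List.Relation.Unary.Unique.Propositional using (Unique)
import Data.List.Relation.Unary.Unique.Propositional.Properties as Unique
open import Data.Nat
open import Data.Nat.ListAction using (sum)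
open import Data.Nat.Properties using (suc-injective)
open import Data.Product using (∃; _×_; _,_; proj₁)
open import Level using (Level)
open import Relation.Binary.PropositionalEquality using (_≡_; _≢_; refl; cong)
open import Relation.Nullary.Decidable using (_×-dec_; _→-dec_)
open import Relation.Unary using (Pred; Decidable)

private
  variable
    a p : Level
    A : Set a

count : {P : Pred A p} → Decidable P → List A → ℕ
count P? xs = length (filter P? xs)

occurrences : ℕ → List ℕ → ℕ
occurrences i = count (_≟ i)

∑ : List A → (A → ℤ) → ℤ
∑ xs f = foldr ℤ._+_ 0ℤ (map f xs)

IsComposition : ℕ → List ℕ → Set
IsComposition n xs = All (1 ≤_) xs × sum xs ≡ n

-- The two ways a composition of n + 1 arises from one of n: prepend a part 1
-- (first part equal to 1), or enlarge the first part (first part at least 2).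
extend : List ℕ → List (List ℕ)
extend []       = (1 ∷ []) ∷ []
extend (x ∷ xs) = (1 ∷ x ∷ xs) ∷ (suc x ∷ xs) ∷ []

-- Each composition of n occurs exactly once in this list; see
-- compositions-sound, compositions-complete and compositions-unique below.
compositions : ℕ → List (List ℕ)
compositions zero    = [] ∷ []
compositions (suc n) = concatMap extend (compositions n)

IsWeaklyDecreasing : List ℕ → Set
IsWeaklyDecreasing = Linked _≥_

isWeaklyDecreasing? : Decidable IsWeaklyDecreasing
isWeaklyDecreasing? = linked? _≥?_

partitions : ℕ → List (List ℕ)
partitions n = filter isWeaklyDecreasing? (compositions n)

-- The index t is 0-based, so the peak belongs to both the initial segment
-- (its last entry) and the final segment (its first entry).
IsUnimodal : List ℕ → Set
IsUnimodal xs = ∃ λ (t : Fin (length xs)) →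
  Linked _≤_ (take (suc (toℕ t)) xs) × Linked _≥_ (drop (toℕ t) xs)

isUnimodal? : Decidable IsUnimodal
isUnimodal? xs = Fin.any? λ t →
  linked? _≤?_ (take (suc (toℕ t)) xs) ×-dec linked? _≥?_ (drop (toℕ t) xs)

-- The value 0 on the empty list is the base value of max.
maxPart : List ℕ → ℕ
maxPart = max 0

MaxAppears : ℕ → List ℕ → Set
MaxAppears m xs = occurrences (maxPart xs) xs ≡ m

maxAppears? : ∀ m → Decidable (MaxAppears m)
maxAppears? m xs = occurrences (maxPart xs) xs ≟ m

u : ℕ → ℕ → ℕ
u zero      zero      = 0
u zero      n@(suc _) = count isUnimodal? (compositions n)
u m@(suc _) n         =
  count (λ xs → isUnimodal? xs ×-dec maxAppears? m xs) (compositions (n + m))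

uℤ : ℕ → ℤ → ℕ
uℤ m (+ n)    = u m n
uℤ m -[1+ _ ] = 0

ω : List ℕ → ℕ
ω = occurrences 1

μ : List ℕ → ℕ
μ xs = count (ω xs <?_) xs

-- The empty partition falls under ω = 0 and gets crank maxPart [] = 0.
crank : List ℕ → ℤ
crank xs with ω xs
... | zero  = + maxPart xs
... | suc _ = + μ xs ℤ.- + ω xs

-- The values at 1 are conventions, not counts.
C₀ C₁ C₂ : ℕ → ℤ
C₀ 1 = 1ℤ
C₀ n = + count (λ xs → 0ℤ ℤ.<? crank xs) (partitions n)
C₁ 1 = 0ℤ
C₁ n = + count (λ xs → 0ℤ ℤ.≤? crank xs) (partitions n)
C₂ 1 = -1ℤ
C₂ n = + count (λ xs → crank xs ℤ.≟ 0ℤ) (partitions n)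

C : Fin 3 → ℕ → ℤ
C 0F = C₀
C 1F = C₁
C 2F = C₂

ContainsUpTo : ℕ → List ℕ → Set
ContainsUpTo k xs = ∀ (i : Fin k) → suc (toℕ i) ∈ xs

containsUpTo? : ∀ k → Decidable (ContainsUpTo k)
containsUpTo? k xs = Fin.all? λ i → _∈?_ _≟_ (suc (toℕ i)) xs

-- Some part q of xs is the smallest among the parts exceeding k, and q
-- appears at least k + 1 times.
FirstLargerRepeats : ℕ → List ℕ → Set
FirstLargerRepeats k xs = Any (λ q →
  k < q × All (λ r → k < r → q ≤ r) xs × suc k ≤ occurrences q xs) xs

firstLargerRepeats? : ∀ k → Decidable (FirstLargerRepeats k)
firstLargerRepeats? k xs = any? (λ q →
  (k <? q) ×-dec (all? (λ r → (k <? r) →-dec (q ≤? r)) xs ×-dec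
                  (suc k ≤? occurrences q xs))) xs

P̃ : ℕ → ℕ → ℕ
P̃ k n =
  count (λ xs → containsUpTo? k xs ×-dec firstLargerRepeats? k xs) (partitions n)

-- The integers -k, …, k.
symmetricRange : ℕ → List ℤ
symmetricRange k = map (λ i → + i ℤ.- + k) (upTo (suc (2 * k)))

-- (-1)^j for an integer j depends only on the parity of |j|.
sgn : ℤ → ℤ
sgn j = -1ℤ ℤ.^ ∣ j ∣

-- The numerator is always even and non-negative, so the division is exact.
pentagonal : ℤ → ℤ
pentagonal j = (j ℤ.* (+ 3 ℤ.* j ℤ.- 1ℤ)) ℤ./ + 2

extend-sound : ∀ {n xs ys} → IsComposition n xs → ys ∈ extend xs →
               IsComposition (suc n) ys
extend-sound {xs = []}     (_ , e)      (here refl)         = s≤s z≤n ∷ [] , cong suc e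
extend-sound {xs = _ ∷ _}  (ps , e)     (here refl)         = s≤s z≤n ∷ ps , cong suc e
extend-sound {xs = _ ∷ _}  (_ ∷ ps , e) (there (here refl)) = s≤s z≤n ∷ ps , cong suc e

compositions-sound : ∀ n {xs} → xs ∈ compositions n → IsComposition n xs
compositions-sound zero    (here refl) = [] , refl
compositions-sound (suc n) xs∈ = go (All.tabulate (compositions-sound n)) (∈-concatMap⁻ extend xs∈)
  where
  go : ∀ {yss ys} → All (IsComposition n) yss → Any (λ xs → ys ∈ extend xs) yss →
       IsComposition (suc n) ys
  go (c ∷ _)  (here ys∈)  = extend-sound c ys∈
  go (_ ∷ cs) (there any) = go cs any

compositions-complete : ∀ n {xs} → IsComposition n xs → xs ∈ compositions n
compositions-complete zero    {[]}                 _            = here refl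
compositions-complete zero    {suc _ ∷ _}          (_ , ())
compositions-complete zero    {zero ∷ _}           (() ∷ _ , _)
compositions-complete (suc n) {[]}                 (_ , ())
compositions-complete (suc n) {zero ∷ _}           (() ∷ _ , _)
compositions-complete (suc n) {suc zero ∷ []}      (_ , e)      = ∈-concatMap⁺ extend
  (Any.map (λ { refl → here refl }) (compositions-complete n ([] , suc-injective e)))
compositions-complete (suc n) {suc zero ∷ x ∷ xs}  (_ ∷ ps , e) = ∈-concatMap⁺ extend
  (Any.map (λ { refl → here refl }) (compositions-complete n (ps , suc-injective e)))
compositions-complete (suc n) {suc (suc x) ∷ xs}   (_ ∷ ps , e) = ∈-concatMap⁺ extend
  (Any.map (λ { refl → there (here refl) })
    (compositions-complete n (s≤s z≤n ∷ ps , suc-injective e)))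

private
  extend-unique : ∀ {xs} → All (1 ≤_) xs → Unique (extend xs)
  extend-unique []          = [] ∷ []
  extend-unique (s≤s _ ∷ _) = ((λ ()) ∷ []) ∷ [] ∷ []

  extend-disjoint : ∀ {xs ys} → All (1 ≤_) xs → All (1 ≤_) ys → xs ≢ ys →
                    Disjoint (extend xs) (extend ys)
  extend-disjoint []          []          neq _ = neq refl
  extend-disjoint []          (_ ∷ _)     _   (here refl , here ())
  extend-disjoint []          (s≤s _ ∷ _) _   (here refl , there (here ()))
  extend-disjoint (_ ∷ _)     []          _   (here () , here refl)
  extend-disjoint (s≤s _ ∷ _) []          _   (there (here ()) , here refl)
  extend-disjoint (_ ∷ _)     (_ ∷ _)     neq (here refl , here refl) = neq refl
  extend-disjoint (_ ∷ _)     (s≤s _ ∷ _) _   (here refl , there (here ()))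
  extend-disjoint (s≤s _ ∷ _) (_ ∷ _)     _   (there (here refl) , here ())
  extend-disjoint (_ ∷ _)     (_ ∷ _)     neq (there (here refl) , there (here refl)) = neq refl

  concatMap-unique : ∀ {xss} → All (All (1 ≤_)) xss → Unique xss →
                     Unique (concatMap extend xss)
  concatMap-unique []       []        = []
  concatMap-unique {xs ∷ _} (p ∷ ps) (d ∷ uss) =
    Unique.++⁺ (extend-unique p) (concatMap-unique ps uss)
      λ { (∈₁ , ∈₂) → go ps d ∈₁ (∈-concatMap⁻ extend ∈₂) }
    where
    go : ∀ {zs yss} → All (All (1 ≤_)) yss → All (xs ≢_) yss →
         zs ∈ extend xs → Any (λ ys → zs ∈ extend ys) yss → ⊥
    go (q ∷ _)  (neq ∷ _)  ∈₁ (here ∈₂)   = extend-disjoint p q neq (∈₁ , ∈₂)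
    go (_ ∷ qs) (_ ∷ neqs) ∈₁ (there ∈₂s) = go qs neqs ∈₁ ∈₂s

compositions-unique : ∀ n → Unique (compositions n)
compositions-unique zero    = [] ∷ []
compositions-unique (suc n) = concatMap-unique
  (All.tabulate λ xs∈ → proj₁ (compositions-sound n xs∈))
  (compositions-unique n)

{-# OPTIONS --safe #-}
module Submission where

-- Write (q)ₘ = (1 - q)⋯(1 - qᵐ).  Summing over Durfee rectangles, the partitions with crank ≥ 0
-- have generating function K = Σ_d q^{d(d+1)} / (q)_d², and, up to the conventions at n = 1, those
-- with crank > 0 have Σ_d q^{d²} (1 - q^d) / (q)_d².  Splitting a unimodal composition at its
-- maximal part gives U₁ = Σ_a q^a / (q)_a², and similar sums for U₀ and U₂ = U₁ - U₀.  A Heine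
-- transformation turns the second kind of sum into the first times 1 / (q)_∞, so that
-- U_m = C_m / (q)_∞ for m = 0, 1, 2.  By induction on k,
--   Σ_{j=-k}^{k} (-1)^j q^{j(3j-1)/2} / (q)_∞ = 1 + (-1)^k Σ_n P̃_k(n) q^n,
-- and multiplying by C_m gives the theorem.  All infinite products and sums are replaced by finite
-- ones (parts at most M) for which the same identities hold exactly, or up to a remainder of
-- order greater than M.

open import Defs
open import Algebra.Bundles using (CommutativeRing)
import Algebra.Solver.Ring
open import Algebra.Solver.Ring.AlmostCommutativeRing using (fromCommutativeRing; _-Raw-AlmostCommutative⟶_)
open import Data.Bool as Bool using (if_then_else_; true; false)
open import Data.Empty using (⊥-elim)
open import Data.Fin as Fin using (Fin; toℕ; fromℕ<)
open import Data.Fin.Patterns using (0F; 1F; 2F)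
import Data.Fin.Properties as Fin
open import Data.Integer as ℤ using (ℤ; +_; -[1+_]; -1ℤ; 0ℤ; 1ℤ; _-_; _*_; _^_)
import Data.Integer.Properties as ℤ
open import Data.Integer.Solver using (module +-*-Solver)
open import Data.List using (List; []; _∷_; _++_; applyUpTo; concatMap; filter; length; map; replicate; upTo)
open import Data.List.Extrema.Nat using (argmax-sel; max≈v⁺; max≤v⁺; xs≤max)
open import Data.List.Membership.Propositional using (_∈_; find; lose)
import Data.List.Properties as List
open import Data.List.Relation.Unary.All as All using (All; []; _∷_)
import Data.List.Relation.Unary.All.Properties as All
open import Data.List.Relation.Unary.Any using (here; there)
open import Data.List.Relation.Unary.Linked using ([]; [-]; _∷_)
open import Data.List.Relation.Unary.Linked.Properties using (Linked⇒All)
open import Data.Maybe using (Maybe; just; nothing)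
open import Data.Nat as ℕ using (ℕ; zero; suc; _∸_; _≤_; _<_; z≤n; s≤s; _≡ᵇ_; _≟_; _≤?_; _<?_; NonZero)
import Data.Nat.DivMod as ℕ
open import Data.Nat.ListAction using (sum)
import Data.Nat.Properties as ℕ
import Data.Nat.Solver
open import Data.Product using (∃; _×_; _,_; proj₁; proj₂)
open import Data.Sum using (_⊎_; inj₁; inj₂)
open import Data.Unit using (⊤; tt)
open import Function using (_∘_; id)
open import Level using (Level; 0ℓ)
open import Relation.Binary.PropositionalEquality using
  (_≡_; _≢_; refl; sym; trans; cong; cong₂; subst; subst₂; module ≡-Reasoning)
open import Relation.Nullary using (¬_; contradiction)
open import Relation.Nullary.Decidable using (Dec; yes; no; does; _×-dec_; dec-true; dec-false)
open import Relation.Unary using (Pred; Decidable)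

-- Every generating function here is pinned down by a recurrence in the bound on the parts, obtained
-- by removing a first part. Typically it reads f = h + q^m f, and since 1 - q^m is invertible, two
-- series with the same recurrence agree; proposed closed forms are verified in this way. What
-- remains is linear algebra over series, left to the ring solver. The Heine step comes down to the
-- two q-Pascal rules for the binomials hidden in `K`: one is the recursion defining `K`, the other
-- is `K-⊕-K`. Together they show that `L t j` and `K t j ⊛ p t` grow in the same way with `t`, and
-- they also sum `D`. The relation U₂ = U₁ - U₀ is already visible peak by peak, because 1/(q)_{b-1}
-- = (1 - q^b)/(q)_b.

private
  variable
    ℓ ℓ′ : Level
    A : Set ℓ
    P : Set ℓ
    Q : Set ℓ′

-- Formal power series

-- Without eta, series given by their coefficients stay folded until a coefficient is taken, so the
-- type checker compares them as ring expressions.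
record Series : Set where
  no-eta-equality
  field
    coeff : ℕ → ℤ
open Series public

infix 4 _≈_
-- Wrapped in a record so that both sides can be inferred from the type of a proof.
record _≈_ (f g : Series) : Set where
  constructor coeffwise
  field
    at : ∀ n → coeff f n ≡ coeff g n
open _≈_ public

infixl 6 _⊕_
infixl 7 _⊛_
infix  8 ⊖_

-- The convolution (f ⊛ g)(n) = Σ f(i) g(n - i), by recursion on n.
convolve : (ℕ → ℤ) → (ℕ → ℤ) → ℕ → ℤ
convolve f g zero    = f 0 ℤ.* g 0
convolve f g (suc n) = f 0 ℤ.* g (suc n) ℤ.+ convolve (f ∘ suc) g n

constant : ℤ → Series
coeff (constant c) zero    = c
coeff (constant c) (suc n) = 0ℤ

_⊕_ : Series → Series → Series
coeff (f ⊕ g) n = coeff f n ℤ.+ coeff g n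

⊖_ : Series → Series
coeff (⊖ f) n = ℤ.- coeff f n

_⊛_ : Series → Series → Series
coeff (f ⊛ g) = convolve (coeff f) (coeff g)

𝟘 𝟙 : Series
𝟘 = constant 0ℤ
𝟙 = constant 1ℤ

-- Coefficient `n` of a product sees only coefficients up to `n` of the factors. This is what lets
-- bounded series stand in for infinite ones.
convolve-cong-≤ : ∀ {f f′ g g′} n → (∀ i → i ≤ n → f i ≡ f′ i) → (∀ i → i ≤ n → g i ≡ g′ i) →
                  convolve f g n ≡ convolve f′ g′ n
convolve-cong-≤ zero    p r = cong₂ ℤ._*_ (p 0 z≤n) (r 0 z≤n)
convolve-cong-≤ (suc n) p r = cong₂ ℤ._+_ (cong₂ ℤ._*_ (p 0 z≤n) (r (suc n) ℕ.≤-refl))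
  (convolve-cong-≤ n (λ i i≤n → p (suc i) (s≤s i≤n)) (λ i i≤n → r i (ℕ.m≤n⇒m≤1+n i≤n)))

module Convolution where
  open +-*-Solver using (solve; _:=_; _:+_; _:*_)

  distribˡ : ∀ f g h n → convolve f (λ i → g i ℤ.+ h i) n ≡ convolve f g n ℤ.+ convolve f h n
  distribˡ f g h zero    = ℤ.*-distribˡ-+ (f 0) (g 0) (h 0)
  distribˡ f g h (suc n) = trans
    (cong (ℤ._+_ (f 0 ℤ.* (g (suc n) ℤ.+ h (suc n)))) (distribˡ (f ∘ suc) g h n))
    (solve 5 (λ a b c d e → a :* (b :+ c) :+ (d :+ e) := (a :* b :+ d) :+ (a :* c :+ e)) refl
      (f 0) (g (suc n)) (h (suc n)) (convolve (f ∘ suc) g n) (convolve (f ∘ suc) h n))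

  -- Swapping the factors reverses the order of summation, so the induction needs the last term
  -- split off as well as the first; `unfoldʳ` provides that.
  comm : ∀ f g n → convolve f g n ≡ convolve g f n
  unfoldʳ : ∀ f g n → convolve f g (suc n) ≡ convolve f (g ∘ suc) n ℤ.+ f (suc n) ℤ.* g 0

  comm f g zero    = ℤ.*-comm (f 0) (g 0)
  comm f g (suc n) = trans (unfoldʳ f g n)
    (trans (cong₂ ℤ._+_ (comm f (g ∘ suc) n) (ℤ.*-comm (f (suc n)) (g 0))) (ℤ.+-comm (convolve (g ∘ suc) f n) _))

  unfoldʳ f g zero    = refl
  unfoldʳ f g (suc n) = trans
    (cong (ℤ._+_ (f 0 ℤ.* g (suc (suc n)))) (unfoldʳ (f ∘ suc) g n))
    (sym (ℤ.+-assoc (f 0 ℤ.* g (suc (suc n))) _ _))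

  scale : ∀ c f g n → convolve (λ i → c ℤ.* f i) g n ≡ c ℤ.* convolve f g n
  scale c f g zero    = ℤ.*-assoc c (f 0) (g 0)
  scale c f g (suc n) = trans
    (cong (ℤ._+_ (c ℤ.* f 0 ℤ.* g (suc n))) (scale c (f ∘ suc) g n))
    (solve 4 (λ a b d e → a :* b :* d :+ a :* e := a :* (b :* d :+ e)) refl
      c (f 0) (g (suc n)) (convolve (f ∘ suc) g n))

  distribʳ : ∀ f g h n → convolve (λ i → g i ℤ.+ h i) f n ≡ convolve g f n ℤ.+ convolve h f n
  distribʳ f g h n = trans (comm _ f n)
    (trans (distribˡ f g h n) (cong₂ ℤ._+_ (comm f g n) (comm f h n)))

  assoc : ∀ f g h n → convolve (convolve f g) h n ≡ convolve f (convolve g h) n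
  assoc f g h zero    = ℤ.*-assoc (f 0) (g 0) (h 0)
  assoc f g h (suc n) = begin
    f 0 ℤ.* g 0 ℤ.* h (suc n) ℤ.+ convolve (λ i → f 0 ℤ.* g (suc i) ℤ.+ convolve (f ∘ suc) g i) h n
      ≡⟨ cong (ℤ._+_ (f 0 ℤ.* g 0 ℤ.* h (suc n))) (distribʳ h (λ i → f 0 ℤ.* g (suc i)) (convolve (f ∘ suc) g) n) ⟩
    f 0 ℤ.* g 0 ℤ.* h (suc n) ℤ.+ (convolve (λ i → f 0 ℤ.* g (suc i)) h n ℤ.+ convolve (convolve (f ∘ suc) g) h n)
      ≡⟨ cong (ℤ._+_ (f 0 ℤ.* g 0 ℤ.* h (suc n))) (cong₂ ℤ._+_ (scale (f 0) (g ∘ suc) h n) (assoc (f ∘ suc) g h n)) ⟩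
    f 0 ℤ.* g 0 ℤ.* h (suc n) ℤ.+ (f 0 ℤ.* convolve (g ∘ suc) h n ℤ.+ convolve (f ∘ suc) (convolve g h) n)
      ≡⟨ solve 5 (λ a b c d e → a :* b :* c :+ (a :* d :+ e) := a :* (b :* c :+ d) :+ e) refl
           (f 0) (g 0) (h (suc n)) (convolve (g ∘ suc) h n) (convolve (f ∘ suc) (convolve g h) n) ⟩
    convolve f (convolve g h) (suc n) ∎
    where open ≡-Reasoning

  constant-scale : ∀ c f n → convolve (coeff (constant c)) f n ≡ c ℤ.* f n
  constant-scale c f zero    = refl
  constant-scale c f (suc n) = trans (cong (ℤ._+_ (c ℤ.* f (suc n))) (scale 0ℤ (λ _ → 0ℤ) f n)) (ℤ.+-identityʳ _)

  identityˡ : ∀ f n → convolve (coeff 𝟙) f n ≡ f n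
  identityˡ f n = trans (constant-scale 1ℤ f n) (ℤ.*-identityˡ (f n))

𝟘-coeff : ∀ n → coeff 𝟘 n ≡ 0ℤ
𝟘-coeff zero    = refl
𝟘-coeff (suc n) = refl

seriesRing : CommutativeRing 0ℓ 0ℓ
seriesRing = record
  { Carrier = Series ; _≈_ = _≈_ ; _+_ = _⊕_ ; _*_ = _⊛_ ; -_ = ⊖_ ; 0# = 𝟘 ; 1# = 𝟙
  ; isCommutativeRing = record
    { isRing = record
      { +-isAbelianGroup = record
        { isGroup = record
          { isMonoid = record
            { isSemigroup = record
              { isMagma = record
                { isEquivalence = record
                  { refl  = coeffwise λ _ → refl
                  ; sym   = λ p → coeffwise λ n → sym (at p n)
                  ; trans = λ p r → coeffwise λ n → trans (at p n) (at r n)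
                  }
                ; ∙-cong = λ p r → coeffwise λ n → cong₂ ℤ._+_ (at p n) (at r n)
                }
              ; assoc = λ f g h → coeffwise λ n → ℤ.+-assoc (coeff f n) (coeff g n) (coeff h n)
              }
            ; identity =
                (λ f → coeffwise λ n → trans (cong (ℤ._+ coeff f n) (𝟘-coeff n)) (ℤ.+-identityˡ (coeff f n))) ,
                (λ f → coeffwise λ n → trans (cong (ℤ._+_ (coeff f n)) (𝟘-coeff n)) (ℤ.+-identityʳ (coeff f n)))
            }
          ; inverse =
              (λ f → coeffwise λ n → trans (ℤ.+-inverseˡ (coeff f n)) (sym (𝟘-coeff n))) ,
              (λ f → coeffwise λ n → trans (ℤ.+-inverseʳ (coeff f n)) (sym (𝟘-coeff n)))
          ; ⁻¹-cong = λ p → coeffwise λ n → cong ℤ.-_ (at p n)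
          }
        ; comm = λ f g → coeffwise λ n → ℤ.+-comm (coeff f n) (coeff g n)
        }
      ; *-cong = λ p r → coeffwise λ n → convolve-cong-≤ n (λ i _ → at p i) (λ i _ → at r i)
      ; *-assoc = λ f g h → coeffwise (Convolution.assoc (coeff f) (coeff g) (coeff h))
      ; *-identity =
          (λ f → coeffwise (Convolution.identityˡ (coeff f))) ,
          (λ f → coeffwise λ n → trans (Convolution.comm (coeff f) (coeff 𝟙) n) (Convolution.identityˡ (coeff f) n))
      ; distrib =
          (λ f g h → coeffwise (Convolution.distribˡ (coeff f) (coeff g) (coeff h))) ,
          (λ f g h → coeffwise (Convolution.distribʳ (coeff f) (coeff g) (coeff h)))
      }
    ; *-comm = λ f g → coeffwise (Convolution.comm (coeff f) (coeff g))
    }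
  }

open CommutativeRing seriesRing public using () renaming
  ( refl to ≈-refl; sym to ≈-sym; trans to ≈-trans; reflexive to ≈-reflexive
  ; +-cong to ⊕-cong; +-congˡ to ⊕-congˡ; +-congʳ to ⊕-congʳ; +-identityˡ to ⊕-identityˡ; +-identityʳ to ⊕-identityʳ
  ; *-cong to ⊛-cong; *-congˡ to ⊛-congˡ; *-congʳ to ⊛-congʳ; *-identityˡ to ⊛-identityˡ; *-identityʳ to ⊛-identityʳ
  ; *-assoc to ⊛-assoc; zeroʳ to ⊛-zeroʳ )

module SeriesSolver where

  -- Equality of series is not decidable, but equality of integers is. Taking integers as solver
  -- coefficients lets like terms cancel.
  constant-homomorphism : CommutativeRing.rawRing ℤ.+-*-commutativeRing -Raw-AlmostCommutative⟶ fromCommutativeRing seriesRing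
  constant-homomorphism = record
    { ⟦_⟧    = constant
    ; +-homo = λ a b → coeffwise λ { zero → refl ; (suc n) → refl }
    ; *-homo = λ a b → coeffwise λ
        { zero    → refl
        ; (suc n) → sym (trans (Convolution.constant-scale a (coeff (constant b)) (suc n)) (ℤ.*-zeroʳ a))
        }
    ; -‿homo = λ a → coeffwise λ { zero → refl ; (suc n) → refl }
    ; 0-homo = ≈-refl
    ; 1-homo = ≈-refl
    }

  constant-≟ : ∀ a b → Maybe (constant a ≈ constant b)
  constant-≟ a b with a ℤ.≟ b
  ... | yes refl = just ≈-refl
  ... | no _     = nothing

  module Solver = Algebra.Solver.Ring
    (CommutativeRing.rawRing ℤ.+-*-commutativeRing) (fromCommutativeRing seriesRing)
    constant-homomorphism constant-≟
  open Solver public using (solve; _:=_; con; _:+_; _:*_; :-_; _:-_)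

  :1 : ∀ {n} → Solver.Polynomial n
  :1 = con 1ℤ

-- Monomials

X : ℕ → Series
coeff (X zero)    n       = coeff 𝟙 n
coeff (X (suc m)) zero    = 0ℤ
coeff (X (suc m)) (suc n) = coeff (X m) n

X-zero : X 0 ≈ 𝟙
X-zero = coeffwise λ _ → refl

X-suc-⊛ : ∀ m f n → coeff (X (suc m) ⊛ f) (suc n) ≡ coeff (X m ⊛ f) n
X-suc-⊛ m f n = ℤ.+-identityˡ _

X-⊛-shift : ∀ m f n → coeff (X m ⊛ f) (m ℕ.+ n) ≡ coeff f n
X-⊛-shift zero    f n = at (≈-trans (⊛-congʳ X-zero) (⊛-identityˡ f)) n
X-⊛-shift (suc m) f n = trans (X-suc-⊛ m f (m ℕ.+ n)) (X-⊛-shift m f n)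

X-⊛-< : ∀ {m n} f → n < m → coeff (X m ⊛ f) n ≡ 0ℤ
X-⊛-< {suc m} {zero}  f _         = refl
X-⊛-< {suc m} {suc n} f (s≤s n<m) = trans (X-suc-⊛ m f n) (X-⊛-< f n<m)

X-+ : ∀ m n → X (m ℕ.+ n) ≈ X m ⊛ X n
X-+ zero    n = ≈-sym (≈-trans (⊛-congʳ X-zero) (⊛-identityˡ (X n)))
X-+ (suc m) n = coeffwise λ where
  zero    → refl
  (suc i) → trans (at (X-+ m n) i) (sym (X-suc-⊛ m (X n) i))

X-split : ∀ {l} m n → l ≡ m ℕ.+ n → X l ≈ X m ⊛ X n
X-split m n refl = X-+ m n

-- Weighted sums over compositions

⟦_⟧ : Dec P → ℤ
⟦ P? ⟧ = if does P? then 1ℤ else 0ℤ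

⟦⟧-yes : (P? : Dec P) → P → ⟦ P? ⟧ ≡ 1ℤ
⟦⟧-yes P? p = cong (if_then 1ℤ else 0ℤ) (dec-true P? p)

⟦⟧-no : (P? : Dec P) → ¬ P → ⟦ P? ⟧ ≡ 0ℤ
⟦⟧-no P? ¬p = cong (if_then 1ℤ else 0ℤ) (dec-false P? ¬p)

⟦⟧-cong : (P? : Dec P) (Q? : Dec Q) → (P → Q) → (Q → P) → ⟦ P? ⟧ ≡ ⟦ Q? ⟧
⟦⟧-cong (yes p) Q? to from = sym (⟦⟧-yes Q? (to p))
⟦⟧-cong (no ¬p) Q? to from = sym (⟦⟧-no Q? (¬p ∘ from))

⟦⟧-× : (P? : Dec P) (Q? : Dec Q) → ⟦ P? ×-dec Q? ⟧ ≡ ⟦ P? ⟧ ℤ.* ⟦ Q? ⟧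
⟦⟧-× (yes _) Q? = sym (ℤ.*-identityˡ ⟦ Q? ⟧)
⟦⟧-× (no _)  Q? = refl

⟦⟧-*-cong : ∀ {x y} (P? : Dec P) → (P → x ≡ y) → ⟦ P? ⟧ ℤ.* x ≡ ⟦ P? ⟧ ℤ.* y
⟦⟧-*-cong (yes p) e = cong (1ℤ ℤ.*_) (e p)
⟦⟧-*-cong (no _)  e = refl

∑-cong : ∀ (xs : List A) {f g} → (∀ x → x ∈ xs → f x ≡ g x) → ∑ xs f ≡ ∑ xs g
∑-cong []       h = refl
∑-cong (x ∷ xs) h = cong₂ ℤ._+_ (h x (here refl)) (∑-cong xs λ y y∈ → h y (there y∈))

∑-zero : ∀ (xs : List A) → ∑ xs (λ _ → 0ℤ) ≡ 0ℤ
∑-zero []       = refl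
∑-zero (x ∷ xs) = trans (ℤ.+-identityˡ _) (∑-zero xs)

∑-+ : ∀ (xs : List A) f g → ∑ xs (λ x → f x ℤ.+ g x) ≡ ∑ xs f ℤ.+ ∑ xs g
∑-+ []       f g = refl
∑-+ (x ∷ xs) f g = trans (cong (ℤ._+_ (f x ℤ.+ g x)) (∑-+ xs f g))
  (solve 4 (λ a b c d → (a :+ b) :+ (c :+ d) := (a :+ c) :+ (b :+ d)) refl (f x) (g x) (∑ xs f) (∑ xs g))
  where open +-*-Solver using (solve; _:=_; _:+_)

count-∑ : ∀ {P : Pred A ℓ′} (P? : Decidable P) xs → + count P? xs ≡ ∑ xs (λ x → ⟦ P? x ⟧)
count-∑ P? []       = refl
count-∑ P? (x ∷ xs) with does (P? x)
... | true  = cong (ℤ._+_ 1ℤ) (count-∑ P? xs)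
... | false = trans (count-∑ P? xs) (sym (ℤ.+-identityˡ _))

∑-filter : ∀ {P : Pred A ℓ′} (P? : Decidable P) xs f → ∑ (filter P? xs) f ≡ ∑ xs (λ x → ⟦ P? x ⟧ ℤ.* f x)
∑-filter P? []       f = refl
∑-filter P? (x ∷ xs) f with does (P? x)
... | true  = cong₂ ℤ._+_ (sym (ℤ.*-identityˡ (f x))) (∑-filter P? xs f)
... | false = trans (∑-filter P? xs f) (sym (ℤ.+-identityˡ _))

Weight : Set
Weight = List ℕ → ℤ

Φ : Weight → Series
coeff (Φ f) n = ∑ (compositions n) f

Φ-cong-at : ∀ n {f g} → (∀ xs → IsComposition n xs → f xs ≡ g xs) → coeff (Φ f) n ≡ coeff (Φ g) n
Φ-cong-at n h = ∑-cong (compositions n) λ xs xs∈ → h xs (compositions-sound n xs∈)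

Φ-cong : ∀ {f g} → (∀ xs → All (1 ≤_) xs → f xs ≡ g xs) → Φ f ≈ Φ g
Φ-cong h = coeffwise λ n → Φ-cong-at n λ xs → h xs ∘ proj₁

Φ-⊕ : ∀ f g → Φ (λ xs → f xs ℤ.+ g xs) ≈ Φ f ⊕ Φ g
Φ-⊕ f g = coeffwise λ n → ∑-+ (compositions n) f g

Φ-constant : ∀ {f} → (∀ x xs → 1 ≤ x → f (x ∷ xs) ≡ 0ℤ) → Φ f ≈ constant (f [])
Φ-constant {f} h = coeffwise λ where
  zero    → ℤ.+-identityʳ (f [])
  (suc n) → trans (Φ-cong-at (suc n) {g = λ _ → 0ℤ} λ where
      []       (_ , ())
      (x ∷ xs) (1≤x ∷ _ , _) → h x xs 1≤x)
    (∑-zero (compositions (suc n)))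

Φ-zero : ∀ {f} → (∀ xs → All (1 ≤_) xs → f xs ≡ 0ℤ) → Φ f ≈ constant 0ℤ
Φ-zero {f} h = ≈-trans (Φ-cong {g = λ _ → 0ℤ} h) (Φ-constant (λ _ _ _ → refl))

private
  -- The weight seen through the second branch of `extend`. The empty composition has no part to
  -- enlarge, hence the value 0.
  bump : Weight → Weight
  bump f []       = 0ℤ
  bump f (x ∷ xs) = f (suc x ∷ xs)

  ∑-extend : ∀ f xss → ∑ (concatMap extend xss) f ≡ ∑ xss (f ∘ (1 ∷_)) ℤ.+ ∑ xss (bump f)
  ∑-extend f []               = refl
  ∑-extend f ([] ∷ xss)       = trans (cong (ℤ._+_ (f (1 ∷ []))) (∑-extend f xss))
    (solve 3 (λ a b c → a :+ (b :+ c) := (a :+ b) :+ (con 0ℤ :+ c)) refl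
      (f (1 ∷ [])) (∑ xss (f ∘ (1 ∷_))) (∑ xss (bump f)))
    where open +-*-Solver using (solve; _:=_; _:+_; con)
  ∑-extend f ((x ∷ xs) ∷ xss) = trans (cong (λ z → f (1 ∷ x ∷ xs) ℤ.+ (f (suc x ∷ xs) ℤ.+ z)) (∑-extend f xss))
    (solve 4 (λ a b c d → a :+ (b :+ (c :+ d)) := (a :+ c) :+ (b :+ d)) refl
      (f (1 ∷ x ∷ xs)) (f (suc x ∷ xs)) (∑ xss (f ∘ (1 ∷_))) (∑ xss (bump f)))
    where open +-*-Solver using (solve; _:=_; _:+_)

  headed : ℕ → Weight → Weight
  headed m f []       = 0ℤ
  headed m f (x ∷ xs) = if x ≡ᵇ m then f (x ∷ xs) else 0ℤ

  -- A first part `suc m` arises by prepending 1 and enlarging it `m` times. Each of these steps is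
  -- one application of `extend`, hence one shift of the exponent.
  Φ-headed : ∀ m f → Φ (headed (suc m) f) ≈ X (suc m) ⊛ Φ (f ∘ (suc m ∷_))
  Φ-headed m f = coeffwise (go m f)
    where
    open ≡-Reasoning
    go : ∀ m f n → coeff (Φ (headed (suc m) f)) n ≡ coeff (X (suc m) ⊛ Φ (f ∘ (suc m ∷_))) n
    go m       f zero    = refl
    go zero    f (suc n) = begin
      coeff (Φ (headed 1 f)) (suc n)                                       ≡⟨ ∑-extend (headed 1 f) (compositions n) ⟩
      coeff (Φ (f ∘ (1 ∷_))) n ℤ.+ coeff (Φ (bump (headed 1 f))) n
        ≡⟨ cong (ℤ._+_ (coeff (Φ (f ∘ (1 ∷_))) n)) (trans (at (Φ-zero bump≡0) n) (𝟘-coeff n)) ⟩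
      coeff (Φ (f ∘ (1 ∷_))) n ℤ.+ 0ℤ                                      ≡⟨ ℤ.+-identityʳ _ ⟩
      coeff (Φ (f ∘ (1 ∷_))) n                                             ≡⟨ X-⊛-shift 1 (Φ (f ∘ (1 ∷_))) n ⟨
      coeff (X 1 ⊛ Φ (f ∘ (1 ∷_))) (suc n)                                 ∎
      where
      bump≡0 : ∀ xs → All (1 ≤_) xs → bump (headed 1 f) xs ≡ 0ℤ
      bump≡0 []           _       = refl
      bump≡0 (suc x ∷ xs) (_ ∷ _) = refl
    go (suc m) f (suc n) = begin
      coeff (Φ (headed (suc (suc m)) f)) (suc n)                           ≡⟨ ∑-extend (headed (suc (suc m)) f) (compositions n) ⟩
      ∑ (compositions n) (λ _ → 0ℤ) ℤ.+ coeff (Φ (bump (headed (suc (suc m)) f))) n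
        ≡⟨ cong₂ ℤ._+_ (∑-zero (compositions n)) (at (Φ-cong bump-headed) n) ⟩
      0ℤ ℤ.+ coeff (Φ (headed (suc m) (bump f))) n                         ≡⟨ ℤ.+-identityˡ _ ⟩
      coeff (Φ (headed (suc m) (bump f))) n                                ≡⟨ go m (bump f) n ⟩
      coeff (X (suc m) ⊛ Φ (f ∘ (suc (suc m) ∷_))) n                       ≡⟨ X-suc-⊛ (suc m) (Φ (f ∘ (suc (suc m) ∷_))) n ⟨
      coeff (X (suc (suc m)) ⊛ Φ (f ∘ (suc (suc m) ∷_))) (suc n)           ∎
      where
      bump-headed : ∀ xs → All (1 ≤_) xs → bump (headed (suc (suc m)) f) xs ≡ headed (suc m) (bump f) xs
      bump-headed []       _ = refl
      bump-headed (x ∷ xs) _ = refl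

-- The source of all recurrences below: `g` carries the compositions whose first part is not
-- `suc m`, and `h` is the weight of the tail once a first part `suc m` has been removed.
Φ-split : ∀ m {f g h} → f [] ≡ g [] → (∀ x xs → 1 ≤ x → x ≢ suc m → f (x ∷ xs) ≡ g (x ∷ xs)) →
          (∀ xs → g (suc m ∷ xs) ≡ 0ℤ) → (∀ xs → All (1 ≤_) xs → f (suc m ∷ xs) ≡ h xs) →
          Φ f ≈ Φ g ⊕ X (suc m) ⊛ Φ h
Φ-split m {f} {g} {h} f[] f≢ g≡0 f≡h =
  ≈-trans (Φ-cong pointwise) (≈-trans (Φ-⊕ g (headed (suc m) f))
    (⊕-congˡ (≈-trans (Φ-headed m f) (⊛-congˡ (Φ-cong f≡h)))))
  where
  pointwise : ∀ xs → All (1 ≤_) xs → f xs ≡ g xs ℤ.+ headed (suc m) f xs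
  pointwise []       _         = trans f[] (sym (ℤ.+-identityʳ _))
  pointwise (x ∷ xs) (1≤x ∷ _) with x ≡ᵇ suc m in eq
  ... | false = trans (f≢ x xs 1≤x (λ x≡ → subst Bool.T eq (ℕ.≡⇒≡ᵇ x (suc m) x≡))) (sym (ℤ.+-identityʳ _))
  ... | true with refl ← ℕ.≡ᵇ⇒≡ x (suc m) (subst Bool.T (sym eq) _) =
    sym (trans (cong (ℤ._+ f (suc m ∷ xs)) (g≡0 xs)) (ℤ.+-identityˡ _))

-- Weighted sums over partitions

-- A virtual first part `m` says at once that `xs` is weakly decreasing and that its parts are at
-- most `m`. Only the coefficients are given, so that `Δ m g` stays folded under unification.
Δ : ℕ → Weight → Series
coeff (Δ m g) = coeff (Φ (λ xs → ⟦ isWeaklyDecreasing? (m ∷ xs) ⟧ ℤ.* g xs))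

Δ-Φ : ∀ m g → Δ m g ≈ Φ (λ xs → ⟦ isWeaklyDecreasing? (m ∷ xs) ⟧ ℤ.* g xs)
Δ-Φ m g = coeffwise λ _ → refl

Δ-cong : ∀ m {g h} → (∀ xs → All (1 ≤_) xs → IsWeaklyDecreasing (m ∷ xs) → g xs ≡ h xs) → Δ m g ≈ Δ m h
Δ-cong m e = coeffwise (at (Φ-cong λ xs 1≤xs → ⟦⟧-*-cong (isWeaklyDecreasing? (m ∷ xs)) (e xs 1≤xs)))

Δ-zero : ∀ g → Δ 0 g ≈ constant (g [])
Δ-zero g = ≈-trans (Δ-Φ 0 g) (≈-trans
  (Φ-constant λ x xs 1≤x → cong (ℤ._* g (x ∷ xs)) (⟦⟧-no (isWeaklyDecreasing? (0 ∷ x ∷ xs)) (λ { (x≤0 ∷ _) → ℕ.<⇒≱ 1≤x x≤0 })))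
  (≈-reflexive (cong constant (ℤ.*-identityˡ (g [])))))

-- Either all parts are at most `m`, or the largest is `suc m`; removing one copy of it leaves the
-- bound `suc m` in force, because further copies may follow.
Δ-suc : ∀ m {g h} → (∀ xs → All (1 ≤_) xs → IsWeaklyDecreasing (suc m ∷ xs) → g (suc m ∷ xs) ≡ h xs) →
        Δ (suc m) g ≈ Δ m g ⊕ X (suc m) ⊛ Δ (suc m) h
Δ-suc m {g} {h} e = coeffwise (at (Φ-split m
    {f = λ xs → ⟦ isWeaklyDecreasing? (suc m ∷ xs) ⟧ ℤ.* g xs} {g = λ xs → ⟦ isWeaklyDecreasing? (m ∷ xs) ⟧ ℤ.* g xs}
    refl
    (λ x xs 1≤x x≢ → cong (ℤ._* g (x ∷ xs)) (⟦⟧-cong (isWeaklyDecreasing? (suc m ∷ x ∷ xs)) (isWeaklyDecreasing? (m ∷ x ∷ xs))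
       (λ { (x≤ ∷ l) → ℕ.<⇒≤pred (ℕ.≤∧≢⇒< x≤ x≢) ∷ l }) (λ { (x≤ ∷ l) → ℕ.m≤n⇒m≤1+n x≤ ∷ l })))
    (λ xs → cong (ℤ._* g (suc m ∷ xs)) (⟦⟧-no (isWeaklyDecreasing? (m ∷ suc m ∷ xs)) (λ { (x≤ ∷ _) → ℕ.1+n≰n x≤ })))
    (λ xs 1≤xs → trans
      (cong (ℤ._* g (suc m ∷ xs)) (⟦⟧-cong (isWeaklyDecreasing? (suc m ∷ suc m ∷ xs)) (isWeaklyDecreasing? (suc m ∷ xs))
        (λ { (_ ∷ l) → l }) (ℕ.≤-refl ∷_)))
      (⟦⟧-*-cong (isWeaklyDecreasing? (suc m ∷ xs)) (e xs 1≤xs)))))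

Δ-𝟘 : ∀ m → Δ m (λ _ → 0ℤ) ≈ 𝟘
Δ-𝟘 m = ≈-trans (Δ-Φ m _) (Φ-zero λ xs _ → ℤ.*-zeroʳ ⟦ isWeaklyDecreasing? (m ∷ xs) ⟧)

head≤sum : ∀ {n x xs} → sum (x ∷ xs) ≡ n → x ≤ n
head≤sum {x = x} refl = ℕ.m≤m+n x _

-- No part of a partition of `n` exceeds `n`, so any bound `m` from `n` on loses nothing.
count-Δ : ∀ {m n g} {P : Pred (List ℕ) ℓ} (P? : Decidable P) → n ≤ m →
          (∀ xs → IsComposition n xs → IsWeaklyDecreasing xs → ⟦ P? xs ⟧ ≡ g xs) →
          + count P? (partitions n) ≡ coeff (Δ m g) n
count-Δ {m = m} {n} {g} P? n≤m e = trans (count-∑ P? (partitions n))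
  (trans (∑-filter isWeaklyDecreasing? (compositions n) _)
    (Φ-cong-at n λ xs c → trans
      (⟦⟧-*-cong (isWeaklyDecreasing? xs) (e xs c))
      (cong (ℤ._* g xs) (⟦⟧-cong (isWeaklyDecreasing? xs) (isWeaklyDecreasing? (m ∷ xs)) (to c) tail))))
  where
  to : ∀ {xs} → IsComposition n xs → IsWeaklyDecreasing xs → IsWeaklyDecreasing (m ∷ xs)
  to {[]}     _       _ = [-]
  to {x ∷ xs} (_ , e) l = ℕ.≤-trans (head≤sum {xs = xs} e) n≤m ∷ l
  tail : ∀ {xs} → IsWeaklyDecreasing (m ∷ xs) → IsWeaklyDecreasing xs
  tail [-]     = []
  tail (_ ∷ l) = l

-- To prove f ≈ g, write f ⊕ ⊖ g as a sum of terms c ⊛ (l ⊕ ⊖ r) with known l ≈ r; the ring solver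
-- checks the decomposition.

infix  7 _·_
infixr 6 _⊞_

_·_ : ∀ c {f g} → f ≈ g → c ⊛ (f ⊕ ⊖ g) ≈ 𝟘
_·_ c {f} {g} f≈g = ≈-trans
  (⊛-congˡ {c} (⊕-congʳ {⊖ g} f≈g))
  (SeriesSolver.solve 2 (λ c g → c :* (g :- g) := con 0ℤ) ≈-refl c g)
  where open SeriesSolver

_⊞_ : ∀ {f g} → f ≈ 𝟘 → g ≈ 𝟘 → f ⊕ g ≈ 𝟘
f≈𝟘 ⊞ g≈𝟘 = ≈-trans (⊕-cong f≈𝟘 g≈𝟘) (⊕-identityˡ 𝟘)

by-combination : ∀ {f g h} → h ≈ 𝟘 → f ⊕ ⊖ g ≈ h → f ≈ g
by-combination {f} {g} h≈𝟘 f-g≈h = ≈-trans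
  (SeriesSolver.solve 2 (λ f g → f := f :- g :+ g) ≈-refl f g)
  (≈-trans (⊕-congʳ {g} (≈-trans f-g≈h h≈𝟘)) (⊕-identityˡ g))
  where open SeriesSolver

-- p m = 1 / (q)ₘ, the generating function of the partitions with parts at most m.
p : ℕ → Series
p m = Δ m (λ _ → 1ℤ)

p-zero : p 0 ≈ 𝟙
p-zero = Δ-zero (λ _ → 1ℤ)

p-suc : ∀ m → p (suc m) ≈ p m ⊕ X (suc m) ⊛ p (suc m)
p-suc m = Δ-suc m λ _ _ _ → refl

-- (q)ₘ
poch : ℕ → Series
poch zero    = 𝟙
poch (suc m) = poch m ⊛ (𝟙 ⊕ ⊖ X (suc m))

poch-⊛-p : ∀ m → poch m ⊛ p m ≈ 𝟙
poch-⊛-p zero    = ≈-trans (⊛-identityˡ (p 0)) p-zero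
poch-⊛-p (suc m) = by-combination (𝟙 · poch-⊛-p m ⊞ poch m · p-suc m)
  (solve 4 (λ c x r s → c :* (:1 :- x) :* s :- :1 := :1 :* (c :* r :- :1) :+ c :* (s :- (r :+ x :* s)))
    ≈-refl (poch m) (X (suc m)) (p m) (p (suc m)))
  where open SeriesSolver

-- The series `poch m ⊛ p (suc m)` is an inverse of `𝟙 ⊕ ⊖ X (suc m)`, so f = h + q^{m+1} f has only
-- one solution.
fixpoint-unique : ∀ m {f g h} → f ≈ h ⊕ X (suc m) ⊛ f → g ≈ h ⊕ X (suc m) ⊛ g → f ≈ g
fixpoint-unique m {f} {g} {h} ef eg = by-combination
  ((⊖ (f ⊕ ⊖ g)) · poch-⊛-p (suc m) ⊞ (poch m ⊛ p (suc m)) · ef ⊞ (⊖ (poch m ⊛ p (suc m))) · eg)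
  (solve 6 (λ c x s f g h → f :- g := :- (f :- g) :* (c :* (:1 :- x) :* s :- :1)
      :+ (c :* s :* (f :- (h :+ x :* f)) :+ :- (c :* s) :* (g :- (h :+ x :* g))))
    ≈-refl (poch m) (X (suc m)) (p (suc m)) f g h)
  where open SeriesSolver

-- Durfee rectangles

-- K t j = Σ_d q^{d(d+1+j)} [t choose d]_q / (q)_{d+j}, defined by a recursion that avoids q-binomials.
K : ℕ → ℕ → Series
K zero    j = p j
K (suc t) j = K t j ⊕ X (suc t) ⊛ X (suc j) ⊛ K t (suc j)

-- L t j = Σ_{i≤t} qⁱ / ((q)ᵢ (q)ᵢ₊ⱼ)
L : ℕ → ℕ → Series
L zero    j = p j
L (suc t) j = L t j ⊕ X (suc t) ⊛ p (suc t) ⊛ p (suc t ℕ.+ j)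

-- Cutting out the largest rectangle of size d × (d + j) gives 1/(q)_{t+1+j} = Σ_d q^{d(d+j)}
-- [t+1 choose d]_q / (q)_{d+j}. The rule [t+1 choose d] = q^d [t choose d] + [t choose d-1] splits
-- this sum into the two terms on the left. The recursion of `K` is the other q-Pascal rule.
K-⊕-K : ∀ t j → K t j ⊕ X (suc j) ⊛ K t (suc j) ≈ p (suc t ℕ.+ j)
K-⊕-K zero    j = ≈-sym (p-suc j)
K-⊕-K (suc t) j = by-combination
  (𝟙 · K-⊕-K t j ⊞ (X (suc t) ⊛ X (suc j)) · ih ⊞ (⊖ 𝟙) · p-suc (suc t ℕ.+ j)
    ⊞ (⊖ p (suc (suc t) ℕ.+ j)) · X-split {suc (suc t) ℕ.+ j} (suc t) (suc j) (cong suc (sym (ℕ.+-suc t j))))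
  (solve 9 (λ a b c x y y′ u v z →
      (a :+ x :* y :* b) :+ y :* (b :+ x :* y′ :* c) :- v :=
      :1 :* (a :+ y :* b :- u) :+ (x :* y :* (b :+ y′ :* c :- v) :+ (:- :1 :* (v :- (u :+ z :* v)) :+ :- v :* (z :- x :* y))))
    ≈-refl (K t j) (K t (suc j)) (K t (suc (suc j))) (X (suc t)) (X (suc j)) (X (suc (suc j)))
      (p (suc t ℕ.+ j)) (p (suc (suc t) ℕ.+ j)) (X (suc (suc t) ℕ.+ j)))
  where
  open SeriesSolver
  ih : K t (suc j) ⊕ X (suc (suc j)) ⊛ K t (suc (suc j)) ≈ p (suc (suc t) ℕ.+ j)
  ih = ≈-trans (K-⊕-K t (suc j)) (≈-reflexive (cong (λ i → p (suc i)) (ℕ.+-suc t j)))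

-- A finite form of Heine's transformation.
L≈K⊛p : ∀ t j → L t j ≈ K t j ⊛ p t
L≈K⊛p zero    j = ≈-sym (≈-trans (⊛-congˡ {p j} p-zero) (⊛-identityʳ (p j)))
L≈K⊛p (suc t) j = by-combination
  (𝟙 · L≈K⊛p t j ⊞ (⊖ K t j) · p-suc t ⊞ (⊖ (X (suc t) ⊛ p (suc t))) · K-⊕-K t j)
  (solve 8 (λ l a b x y r s w →
      l :+ x :* s :* w :- (a :+ x :* y :* b) :* s :=
      :1 :* (l :- a :* r) :+ (:- a :* (s :- (r :+ x :* s)) :+ :- (x :* s) :* (a :+ y :* b :- w)))
    ≈-refl (L t j) (K t j) (K t (suc j)) (X (suc t)) (X (suc j)) (p t) (p (suc t)) (p (suc t ℕ.+ j)))
  where open SeriesSolver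

-- D t = Σ_{1≤i≤t} qⁱ K (i - 1) 0
D : ℕ → Series
D zero    = 𝟘
D (suc t) = D t ⊕ X (suc t) ⊛ K t 0

-- Solved for `D`, this is the closed form q (1 - q^{t+1}) `K t 1`, whose increments are matched
-- through `K-⊕-K` at 0 and 1. The extra term on the left has order above t + 1; up to there
-- `D (suc t)` is `X 1 ⊛ K t 1`, which tends to Σ_d q^{d²} (1 - q^d) / (q)_d².
D-⊕-K : ∀ t → D (suc t) ⊕ X (suc (suc t)) ⊛ K t 1 ≈ X 1 ⊛ K t 1
D-⊕-K zero    = by-combination ((⊖ X 1) · p-suc 0 ⊞ p 1 · X-+ 1 1)
  (solve 4 (λ q q² r s → (con 0ℤ :+ q :* r) :+ q² :* s :- q :* s := :- q :* (s :- (r :+ q :* s)) :+ s :* (q² :- q :* q))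
    ≈-refl (X 1) (X 2) (p 0) (p 1))
  where open SeriesSolver
D-⊕-K (suc t) = by-combination
  (𝟙 · D-⊕-K t ⊞ z · K-⊕-K t 0 ⊞ (z ⊛ z ⊕ ⊖ z) · K-⊕-K t 1 ⊞ (⊖ z) · p-rec
    ⊞ (X 2 ⊛ K t 2 ⊕ ⊖ (z ⊛ (K t 1 ⊕ X 2 ⊛ K t 2))) · X-+ 1 (suc t)
    ⊞ (K t 1 ⊕ X (suc t) ⊛ X 2 ⊛ K t 2) · X-+ 1 (suc (suc t)))
  (solve 11 (λ d a b c q x z z₃ q₂ w w′ →
      (d :+ z :* (a :+ x :* q :* b)) :+ z₃ :* (b :+ x :* q₂ :* c) :- q :* (b :+ x :* q₂ :* c) :=
      :1 :* (d :+ z :* b :- q :* b) :+ (z :* (a :+ q :* b :- w) :+ ((z :* z :- z) :* (b :+ q₂ :* c :- w′)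
        :+ (:- z :* (w′ :- (w :+ z :* w′)) :+ ((q₂ :* c :- z :* (b :+ q₂ :* c)) :* (z :- q :* x)
        :+ (b :+ x :* q₂ :* c) :* (z₃ :- q :* z))))))
    ≈-refl (D (suc t)) (K t 0) (K t 1) (K t 2) (X 1) (X (suc t)) z (X (suc (suc (suc t)))) (X 2)
      (p (suc t ℕ.+ 0)) (p (suc t ℕ.+ 1)))
  where
  open SeriesSolver
  z : Series
  z = X (suc (suc t))
  p-rec : p (suc t ℕ.+ 1) ≈ p (suc t ℕ.+ 0) ⊕ z ⊛ p (suc t ℕ.+ 1)
  p-rec rewrite ℕ.+-identityʳ t | ℕ.+-comm t 1 = p-suc (suc t)

-- The truncated pentagonal number theorem

triangular : ℕ → ℕ
triangular zero    = 0
triangular (suc k) = suc k ℕ.+ triangular k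

-- `B k m` stands for the generating function of `P̃ k` restricted to parts at most `m`; the
-- argument uses only its recurrence. The middle term of `B-suc` is the case in which removing one
-- copy of `suc m` destroys the property: exactly k + 1 copies of it over a partition with parts at
-- most `k` that contains 1, ..., k.
module TruncatedPentagonal
  (B : ℕ → ℕ → Series)
  (B-start : ∀ k → B k k ≈ 𝟘)
  (B-suc   : ∀ {k m} → k ≤ m →
             B k (suc m) ≈ B k m ⊕ X (suc k ℕ.* suc m) ⊛ (X (triangular k) ⊛ p k) ⊕ X (suc m) ⊛ B k (suc m))
  where
  open SeriesSolver

  -- The price of bounding the parts by `m`. Its order exceeds `m`, so it disappears in the limit.
  remainder : ℕ → ℕ → Series
  remainder k m = X (suc k ℕ.* suc m) ⊛ (X (triangular k) ⊛ p (suc k))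

  -- The right side is the pair of pentagonal terms for ±(k+1) over (q)_m: k(k+1)/2 + (k+1)² =
  -- (k+1)(3k+2)/2, and a further k + 1 gives the exponent for -(k+1). Both sides satisfy the same
  -- recurrence in the bound, starting from k + 1.
  B-⊕-B : ∀ k d → B (suc k) (suc d ℕ.+ k) ⊕ B k (suc d ℕ.+ k) ⊕ remainder k (suc d ℕ.+ k)
                  ≈ X (triangular k ℕ.+ suc k ℕ.* suc k) ⊛ (𝟙 ⊕ X (suc k)) ⊛ p (suc d ℕ.+ k)
  B-⊕-B k zero = by-combination
    (𝟙 · B-start (suc k) ⊞ 𝟙 · B-k
      ⊞ (X (triangular k) ⊛ p (suc k)) · X-split {suc k ℕ.* suc (suc k)} (suc k) (suc k ℕ.* suc k) (ℕ.*-suc (suc k) (suc k))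
      ⊞ (⊖ ((𝟙 ⊕ X (suc k)) ⊛ p (suc k))) · X-+ (triangular k) (suc k ℕ.* suc k))
    (solve 8 (λ b′ b e e′ t s P te →
        b′ :+ b :+ e′ :* (t :* P) :- te :* (:1 :+ s) :* P :=
        :1 :* (b′ :- con 0ℤ) :+ (:1 :* (b :- e :* (t :* P)) :+ (t :* P :* (e′ :- s :* e) :+ :- ((:1 :+ s) :* P) :* (te :- t :* e))))
      ≈-refl (B (suc k) (suc k)) (B k (suc k)) (X (suc k ℕ.* suc k)) (X (suc k ℕ.* suc (suc k))) (X (triangular k)) (X (suc k))
        (p (suc k)) (X (triangular k ℕ.+ suc k ℕ.* suc k)))
    where
    B-k : B k (suc k) ≈ X (suc k ℕ.* suc k) ⊛ (X (triangular k) ⊛ p (suc k))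
    B-k = fixpoint-unique k (B-suc ℕ.≤-refl) (by-combination
      ((X (suc k ℕ.* suc k) ⊛ X (triangular k)) · p-suc k ⊞ (⊖ 𝟙) · B-start k)
      (solve 6 (λ b e t s P P′ →
          e :* (t :* P′) :- (b :+ e :* (t :* P) :+ s :* (e :* (t :* P′))) :=
          e :* t :* (P′ :- (P :+ s :* P′)) :+ :- :1 :* (b :- con 0ℤ))
        ≈-refl (B k k) (X (suc k ℕ.* suc k)) (X (triangular k)) (X (suc k)) (p k) (p (suc k))))
  B-⊕-B k (suc d) = fixpoint-unique m
    (by-combination
      (𝟙 · B-suc {suc k} (ℕ.s≤s (ℕ.m≤n+m k d)) ⊞ 𝟙 · B-suc {k} (ℕ.m≤n⇒m≤1+n (ℕ.m≤n+m k d)) ⊞ 𝟙 · B-⊕-B k d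
        ⊞ (⊖ (X (suc k ℕ.* suc m) ⊛ X (triangular k))) · p-suc k
        ⊞ (X (triangular k) ⊛ p (suc k) ⊕ ⊖ (z ⊛ (X (triangular k) ⊛ p (suc k))))
          · X-split {suc k ℕ.* suc (suc m)} (suc k) (suc k ℕ.* suc m) (ℕ.*-suc (suc k) (suc m))
        ⊞ (X (triangular (suc k)) ⊛ p (suc k)) · X-+ (suc m) (suc k ℕ.* suc m)
        ⊞ (z ⊛ X (suc k ℕ.* suc m) ⊛ p (suc k)) · X-+ (suc k) (triangular k))
      (solve 14 (λ b₁′ b₁ b₀′ b₀ e ze se t t′ s z P P′ A →
          (b₁′ :+ b₀′ :+ se :* (t :* P′)) :- (A :+ z :* (b₁′ :+ b₀′ :+ se :* (t :* P′))) :=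
          :1 :* (b₁′ :- (b₁ :+ ze :* (t′ :* P′) :+ z :* b₁′)) :+ (:1 :* (b₀′ :- (b₀ :+ e :* (t :* P) :+ z :* b₀′))
            :+ (:1 :* (b₁ :+ b₀ :+ e :* (t :* P′) :- A) :+ (:- (e :* t) :* (P′ :- (P :+ s :* P′))
            :+ ((t :* P′ :- z :* (t :* P′)) :* (se :- s :* e) :+ (t′ :* P′ :* (ze :- z :* e) :+ z :* e :* P′ :* (t′ :- s :* t)))))))
        ≈-refl (B (suc k) (suc m)) (B (suc k) m) (B k (suc m)) (B k m) (X (suc k ℕ.* suc m)) (X (suc (suc k) ℕ.* suc m))
          (X (suc k ℕ.* suc (suc m))) (X (triangular k)) (X (triangular (suc k))) (X (suc k)) z (p k) (p (suc k))
          (X (triangular k ℕ.+ suc k ℕ.* suc k) ⊛ (𝟙 ⊕ X (suc k)) ⊛ p m)))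
    (by-combination ((X (triangular k ℕ.+ suc k ℕ.* suc k) ⊛ (𝟙 ⊕ X (suc k))) · p-suc m)
      (solve 4 (λ a z P P′ → a :* P′ :- (a :* P :+ z :* (a :* P′)) := a :* (P′ :- (P :+ z :* P′)))
        ≈-refl (X (triangular k ℕ.+ suc k ℕ.* suc k) ⊛ (𝟙 ⊕ X (suc k))) z (p m) (p (suc m))))
    where
    m = suc d ℕ.+ k
    z : Series
    z = X (suc m)

module _ {P : Pred A ℓ′} (P? : Decidable P) where

  count-accept : ∀ x xs → P x → count P? (x ∷ xs) ≡ suc (count P? xs)
  count-accept x xs px = cong length (List.filter-accept P? {xs = xs} px)

  count-reject : ∀ x xs → ¬ P x → count P? (x ∷ xs) ≡ count P? xs
  count-reject x xs ¬px = cong length (List.filter-reject P? {xs = xs} ¬px)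

  count-none : ∀ xs → All (¬_ ∘ P) xs → count P? xs ≡ 0
  count-none xs ¬pxs = cong length (List.filter-none P? {xs = xs} ¬pxs)

-- Cranks

decreasing⇒bounded : ∀ {m xs} → IsWeaklyDecreasing (m ∷ xs) → All (_≤ m) xs
decreasing⇒bounded [-]          = []
decreasing⇒bounded (x≤m ∷ rest) = Linked⇒All (λ y≤x z≤y → ℕ.≤-trans z≤y y≤x) x≤m rest

μ-none : ∀ xs → All (_≤ ω xs) xs → μ xs ≡ 0
μ-none xs xs≤ω = count-none (ω xs <?_) xs (All.map ℕ.≤⇒≯ xs≤ω)

ω-reject : ∀ x xs → 2 ≤ x → ω (x ∷ xs) ≡ ω xs
ω-reject x xs 2≤x = count-reject (_≟ 1) x xs λ { refl → ℕ.1+n≰n 2≤x }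

ω-accept : ∀ xs → ω (1 ∷ xs) ≡ suc (ω xs)
ω-accept xs = count-accept (_≟ 1) 1 xs refl

-- A part x above the diagonal can be removed from the comparison of ω and μ: if x ≤ ω then both
-- inequalities fail.
module DurfeeShift (c d : ℕ) {x xs} (2≤x : 2 ≤ x) (dec : IsWeaklyDecreasing (x ∷ xs)) (d<x+c : suc d < x ℕ.+ c) where

  private
    large : x ≤ ω xs → ¬ ω xs ℕ.+ c ≤ suc d ℕ.+ 0
    large x≤ω le = ℕ.<⇒≱ d<x+c (ℕ.≤-trans (ℕ.+-monoˡ-≤ c x≤ω) (ℕ.≤-trans le (ℕ.≤-reflexive (ℕ.+-identityʳ _))))

    μ-∷ : ω xs < x → μ (x ∷ xs) ≡ suc (μ xs)
    μ-∷ ω<x rewrite ω-reject x xs 2≤x = count-accept (ω xs <?_) x xs ω<x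

    μ-∷-none : x ≤ ω xs → μ (x ∷ xs) ≡ 0
    μ-∷-none x≤ω = μ-none (x ∷ xs) (subst (λ w → All (_≤ w) (x ∷ xs)) (sym (ω-reject x xs 2≤x))
      (x≤ω ∷ All.map (λ y≤x → ℕ.≤-trans y≤x x≤ω) (decreasing⇒bounded dec)))

    μ-tail-none : x ≤ ω xs → μ xs ≡ 0
    μ-tail-none x≤ω = μ-none xs (All.map (λ y≤x → ℕ.≤-trans y≤x x≤ω) (decreasing⇒bounded dec))

  to : ω (x ∷ xs) ℕ.+ c ≤ d ℕ.+ μ (x ∷ xs) → ω xs ℕ.+ c ≤ suc d ℕ.+ μ xs
  to le with ω xs <? x
  ... | yes ω<x = subst₂ (λ v w → v ℕ.+ c ≤ w) (ω-reject x xs 2≤x) (trans (cong (d ℕ.+_) (μ-∷ ω<x)) (ℕ.+-suc d (μ xs))) le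
  ... | no  ω≮x = ⊥-elim (large (ℕ.≮⇒≥ ω≮x) (ℕ.m≤n⇒m≤1+n
    (subst₂ (λ v w → v ℕ.+ c ≤ d ℕ.+ w) (ω-reject x xs 2≤x) (μ-∷-none (ℕ.≮⇒≥ ω≮x)) le)))

  from : ω xs ℕ.+ c ≤ suc d ℕ.+ μ xs → ω (x ∷ xs) ℕ.+ c ≤ d ℕ.+ μ (x ∷ xs)
  from le with ω xs <? x
  ... | yes ω<x = subst₂ (λ v w → v ℕ.+ c ≤ w) (sym (ω-reject x xs 2≤x))
    (sym (trans (cong (d ℕ.+_) (μ-∷ ω<x)) (ℕ.+-suc d (μ xs)))) le
  ... | no  ω≮x = ⊥-elim (large (ℕ.≮⇒≥ ω≮x) (subst (λ w → ω xs ℕ.+ c ≤ suc d ℕ.+ w) (μ-tail-none (ℕ.≮⇒≥ ω≮x)) le))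

-- ⟦ crank ≥ 0 ⟧ for the partition obtained by putting j large parts in front of xs.
κ : ℕ → Weight
κ j xs = ⟦ ω xs ≤? j ℕ.+ μ xs ⟧

κ-shift : ∀ j {x xs} → suc (suc j) ≤ x → IsWeaklyDecreasing (x ∷ xs) → κ j (x ∷ xs) ≡ κ (suc j) xs
κ-shift j {x} {xs} j+2≤x dec = ⟦⟧-cong (ω (x ∷ xs) ≤? j ℕ.+ μ (x ∷ xs)) (ω xs ≤? suc j ℕ.+ μ xs)
  (subst (_≤ suc j ℕ.+ μ xs) (ℕ.+-identityʳ _) ∘ to ∘ subst (_≤ j ℕ.+ μ (x ∷ xs)) (sym (ℕ.+-identityʳ _)))
  (subst (_≤ j ℕ.+ μ (x ∷ xs)) (ℕ.+-identityʳ _) ∘ from ∘ subst (_≤ suc j ℕ.+ μ xs) (sym (ℕ.+-identityʳ _)))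
  where open DurfeeShift 0 j (ℕ.≤-trans (s≤s (s≤s z≤n)) j+2≤x) dec (ℕ.≤-trans j+2≤x (ℕ.m≤m+n x 0))

-- As soon as `ω` exceeds `j`, no part is larger than `ω`, so `μ` is 0 and cannot rescue the
-- inequality.
κ-bounded : ∀ j {xs} → All (_≤ suc j) xs → κ j xs ≡ ⟦ ω xs ≤? j ⟧
κ-bounded j {xs} xs≤ = ⟦⟧-cong (ω xs ≤? j ℕ.+ μ xs) (ω xs ≤? j) to (λ ω≤j → ℕ.≤-trans ω≤j (ℕ.m≤m+n j (μ xs)))
  where
  to : ω xs ≤ j ℕ.+ μ xs → ω xs ≤ j
  to le with ω xs ≤? j
  ... | yes ω≤j = ω≤j
  ... | no  ω≰j = subst (ω xs ≤_)
    (trans (cong (j ℕ.+_) (μ-none xs (All.map (λ x≤ → ℕ.≤-trans x≤ (ℕ.≰⇒> ω≰j)) xs≤))) (ℕ.+-identityʳ j)) le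

-- Allowing at most `j` ones turns the factor 1/(1 - q) of 1/(q)_{m+1} into (1 - q^{j+1})/(1 - q).
-- Larger parts leave `ω` alone, so they only contribute their usual factors.
Δ-ω : ∀ m j → Δ (suc m) (λ xs → ⟦ ω xs ≤? j ⟧) ≈ (𝟙 ⊕ ⊖ X (suc j)) ⊛ p (suc m)
Δ-ω zero zero = ≈-trans
  (Δ-suc 0 {h = λ _ → 0ℤ} λ xs _ _ → ⟦⟧-no (ω (1 ∷ xs) ≤? 0) (subst (λ w → ¬ w ≤ 0) (sym (ω-accept xs)) λ ()))
  (≈-trans (⊕-cong (Δ-zero _) (⊛-congˡ {X 1} (Δ-𝟘 1)))
    (by-combination ((⊖ 𝟙) · p-suc 0 ⊞ (⊖ 𝟙) · p-zero)
      (solve 3 (λ q P P′ → (:1 :+ q :* con 0ℤ) :- (:1 :- q) :* P′ :=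
          :- :1 :* (P′ :- (P :+ q :* P′)) :+ :- :1 :* (P :- :1)) ≈-refl (X 1) (p 0) (p 1))))
  where
  open SeriesSolver
Δ-ω zero (suc j) = ≈-trans
  (Δ-suc 0 {h = λ xs → ⟦ ω xs ≤? j ⟧} λ xs _ _ → ⟦⟧-cong (ω (1 ∷ xs) ≤? suc j) (ω xs ≤? j)
    (ℕ.≤-pred ∘ subst (_≤ suc j) (ω-accept xs)) (subst (_≤ suc j) (sym (ω-accept xs)) ∘ s≤s))
  (≈-trans (⊕-cong (Δ-zero _) (⊛-congˡ {X 1} (Δ-ω 0 j)))
    (by-combination ((⊖ 𝟙) · p-suc 0 ⊞ (⊖ 𝟙) · p-zero ⊞ p 1 · X-+ 1 (suc j))
      (solve 5 (λ q x y P P′ → (:1 :+ q :* ((:1 :- x) :* P′)) :- (:1 :- y) :* P′ :=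
          :- :1 :* (P′ :- (P :+ q :* P′)) :+ (:- :1 :* (P :- :1) :+ P′ :* (y :- q :* x)))
        ≈-refl (X 1) (X (suc j)) (X (suc (suc j))) (p 0) (p 1))))
  where open SeriesSolver
Δ-ω (suc m) j = fixpoint-unique (suc m)
  (Δ-suc (suc m) λ xs _ _ → cong (λ w → ⟦ w ≤? j ⟧) (ω-reject (suc (suc m)) xs (s≤s (s≤s z≤n))))
  (≈-trans
    (by-combination ((𝟙 ⊕ ⊖ X (suc j)) · p-suc (suc m))
      (solve 4 (λ c z P P′ → c :* P′ :- (c :* P :+ z :* (c :* P′)) := c :* (P′ :- (P :+ z :* P′)))
        ≈-refl (𝟙 ⊕ ⊖ X (suc j)) (X (suc (suc m))) (p (suc m)) (p (suc (suc m)))))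
    (⊕-congʳ (≈-sym (Δ-ω m j))))
  where open SeriesSolver

-- The bound is t + 1 + j because removing a largest part t + 2 + j moves one unit from `t` to `j`:
-- that part joins the large parts counted by `κ`. This is exactly the recursion of `K`. At t = 0 at
-- most `j` ones are allowed, and the factor 1 - q^{j+1} cancels the largest admissible part.
Δ-κ : ∀ t j → Δ (suc t ℕ.+ j) (κ j) ≈ K t j
Δ-κ zero    j = ≈-trans (Δ-cong (suc j) λ xs _ dec → κ-bounded j (decreasing⇒bounded dec))
  (≈-trans (Δ-ω j j) (by-combination (𝟙 · p-suc j)
    (solve 3 (λ x P P′ → (:1 :- x) :* P′ :- P := :1 :* (P′ :- (P :+ x :* P′))) ≈-refl (X (suc j)) (p j) (p (suc j)))))
  where open SeriesSolver
Δ-κ (suc t) j = ≈-trans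
  (Δ-suc (suc t ℕ.+ j) λ xs _ dec → κ-shift j (s≤s (s≤s (ℕ.m≤n+m j t))) dec)
  (⊕-cong (Δ-κ t j) (⊛-cong (X-split (suc t) (suc j) (cong suc (sym (ℕ.+-suc t j))))
    (≈-trans (≈-reflexive (cong (λ i → Δ (suc i) (κ (suc j))) (sym (ℕ.+-suc t j)))) (Δ-κ t (suc j)))))

Δ-κ₀ : ∀ t → Δ (suc t) (κ 0) ≈ K t 0
Δ-κ₀ t = subst (λ m → Δ (suc m) (κ 0) ≈ K t 0) (ℕ.+-identityʳ t) (Δ-κ t 0)

crank-without-ones : ∀ xs → ω xs ≡ 0 → crank xs ≡ + maxPart xs
crank-without-ones xs eq with ω xs
crank-without-ones xs refl | zero = refl

crank-with-ones : ∀ xs → ω xs ≢ 0 → crank xs ≡ + μ xs ℤ.- + ω xs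
crank-with-ones xs = go λ { _ refl → refl }
  where
  -- Quantifying over ys keeps the with-abstraction of ω xs away from the hypothesis.
  go : ∀ {c} → (∀ ys → ys ≡ xs → + μ ys ℤ.- + ω ys ≡ c) → ω xs ≢ 0 → crank xs ≡ c
  go e ω≢0 with ω xs
  ... | zero  = contradiction refl ω≢0
  ... | suc _ = e xs refl

0≤crank⇒ω≤μ : ∀ xs → 0ℤ ℤ.≤ crank xs → ω xs ≤ μ xs
0≤crank⇒ω≤μ xs le with ω xs ≟ 0
... | yes ω≡0 = subst (_≤ μ xs) (sym ω≡0) z≤n
... | no  ω≢0 = ℤ.drop‿+≤+ (ℤ.0≤i-j⇒j≤i (subst (0ℤ ℤ.≤_) (crank-with-ones xs ω≢0) le))

ω≤μ⇒0≤crank : ∀ xs → ω xs ≤ μ xs → 0ℤ ℤ.≤ crank xs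
ω≤μ⇒0≤crank xs le with ω xs ≟ 0
... | yes ω≡0 = subst (0ℤ ℤ.≤_) (sym (crank-without-ones xs ω≡0)) (ℤ.+≤+ z≤n)
... | no  ω≢0 = subst (0ℤ ℤ.≤_) (sym (crank-with-ones xs ω≢0)) (ℤ.i≤j⇒0≤j-i (ℤ.+≤+ le))

0<crank⇒ω<μ : ∀ xs → All (1 ≤_) xs → 0ℤ ℤ.< crank xs → ω xs < μ xs
0<crank⇒ω<μ []         _         (ℤ.+<+ ())
0<crank⇒ω<μ xs@(x ∷ _) (1≤x ∷ _) lt with ω xs ≟ 0
... | yes ω≡0 = subst (_< μ xs) (sym ω≡0) (List.filter-some (ω xs <?_) {xs = xs} (here (subst (_< x) (sym ω≡0) 1≤x)))
... | no  ω≢0 = ℕ.≤∧≢⇒< (0≤crank⇒ω≤μ xs (ℤ.<⇒≤ lt)) λ ω≡μ →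
  ℤ.<-irrefl refl (subst (0ℤ ℤ.<_) (trans (crank-with-ones xs ω≢0)
    (trans (cong (λ i → + i ℤ.- + ω xs) (sym ω≡μ)) (ℤ.+-inverseʳ (+ ω xs)))) lt)

ω<μ⇒0<crank : ∀ xs → ω xs < μ xs → 0ℤ ℤ.< crank xs
ω<μ⇒0<crank xs lt with ω xs ≟ 0
... | yes ω≡0 = subst (0ℤ ℤ.<_) (sym (crank-without-ones xs ω≡0)) (ℤ.+<+ (0<max xs lt))
  where
  0<max : ∀ xs → ω xs < μ xs → 0 < maxPart xs
  0<max (x ∷ xs) lt with 0 <? maxPart (x ∷ xs)
  ... | yes 0<m = 0<m
  ... | no  0≮m = contradiction (subst (ω (x ∷ xs) <_)
    (μ-none (x ∷ xs) (All.map (λ y≤m → ℕ.≤-trans y≤m (ℕ.≤-trans (ℕ.≮⇒≥ 0≮m) z≤n)) (xs≤max 0 (x ∷ xs)))) lt) λ ()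
... | no  ω≢0 = ℤ.≤∧≢⇒< (ω≤μ⇒0≤crank xs (ℕ.<⇒≤ lt)) λ 0≡c →
  ℕ.<-irrefl (sym (ℤ.+-injective (ℤ.i-j≡0⇒i≡j _ _ (trans (sym (crank-with-ones xs ω≢0)) (sym 0≡c))))) lt

-- Removing the largest part.  The weight is wrong only at the partition 1 of 1, which
-- is where the convention C₀ 1 = 1 departs from the count.
δ : Weight
δ []       = 0ℤ
δ (x ∷ xs) = κ 0 xs

Δ-δ : ∀ m → Δ m δ ≈ D m
Δ-δ zero    = Δ-zero δ
Δ-δ (suc m) = ≈-trans (Δ-suc m λ _ _ _ → refl)
  (⊕-cong (Δ-δ m) (⊛-congˡ {X (suc m)} (Δ-κ₀ m)))

-- Removing a largest part x ≥ 2 keeps `ω` and lowers `μ` by one if x > ω, so ω < μ becomes ω ≤ μ;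
-- if x ≤ ω, both fail. For two or more parts all equal to 1 both sides are 0, and a single 1 is
-- excluded by `n ≢ 1`.
0<crank-δ : ∀ {n} xs → n ≢ 1 → IsComposition n xs → IsWeaklyDecreasing xs → ⟦ 0ℤ ℤ.<? crank xs ⟧ ≡ δ xs
0<crank-δ [] _ _ _ = refl
0<crank-δ (zero ∷ _) _ (() ∷ _ , _) _
0<crank-δ (1 ∷ []) n≢1 (_ , refl) _ = contradiction refl n≢1
0<crank-δ {n} (1 ∷ xs@(x ∷ ys)) n≢1 (1≤ , _) dec = trans
  (⟦⟧-no (0ℤ ℤ.<? crank (1 ∷ xs)) λ 0<c → ℕ.n≮0
    (subst (ω (1 ∷ xs) <_) (μ-none (1 ∷ xs) (≤ω 1≤ω)) (0<crank⇒ω<μ (1 ∷ xs) 1≤ 0<c)))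
  (sym (⟦⟧-no (ω xs ≤? 0 ℕ.+ μ xs) λ ω≤μ → ℕ.1+n≰n (ℕ.≤-trans 1≤ω-tail
    (subst (ω xs ≤_) (μ-none xs (All.map (λ y≤1 → ℕ.≤-trans y≤1 1≤ω-tail) xs≤1)) ω≤μ))))
  where
  xs≤1 : All (_≤ 1) xs
  xs≤1 = decreasing⇒bounded dec
  1≤ω-tail : 1 ≤ ω xs
  1≤ω-tail = List.filter-some (_≟ 1) {xs = xs} (here (ℕ.≤-antisym (All.head xs≤1) (All.head (All.tail 1≤))))
  1≤ω : 1 ≤ ω (1 ∷ xs)
  1≤ω = List.filter-some (_≟ 1) {xs = 1 ∷ xs} (here refl)
  ≤ω : ∀ {w} → 1 ≤ w → All (_≤ w) (1 ∷ xs)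
  ≤ω 1≤w = 1≤w ∷ All.map (λ y≤1 → ℕ.≤-trans y≤1 1≤w) xs≤1
0<crank-δ (x@(suc (suc _)) ∷ xs) _ (1≤ , _) dec = ⟦⟧-cong (0ℤ ℤ.<? crank (x ∷ xs)) (ω xs ≤? 0 ℕ.+ μ xs)
  (λ 0<c → ℕ.≤-pred (subst (_≤ suc (μ xs)) (ℕ.+-comm (ω xs) 1)
    (to (subst (_≤ μ (x ∷ xs)) (ℕ.+-comm 1 _) (0<crank⇒ω<μ (x ∷ xs) 1≤ 0<c)))))
  (λ le → ω<μ⇒0<crank (x ∷ xs) (subst (_≤ μ (x ∷ xs)) (ℕ.+-comm _ 1)
    (from (subst (_≤ suc (μ xs)) (ℕ.+-comm 1 (ω xs)) (s≤s le)))))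
  -- The offset 1 makes the comparison strict, as positive crank requires.
  where open DurfeeShift 1 0 {x} {xs} (s≤s (s≤s z≤n)) dec (s≤s (s≤s z≤n))

C₁≡ : ∀ {n} M → n ≤ suc M → C₁ n ≡ coeff (K M 0) n
C₁≡ {n} M n≤ = trans (lemma n n≤) (at (Δ-κ₀ M) n)
  where
  0≤crank-κ : ∀ xs → ⟦ 0ℤ ℤ.≤? crank xs ⟧ ≡ κ 0 xs
  0≤crank-κ xs = ⟦⟧-cong (0ℤ ℤ.≤? crank xs) (ω xs ≤? μ xs) (0≤crank⇒ω≤μ xs) (ω≤μ⇒0≤crank xs)
  lemma : ∀ n → n ≤ suc M → C₁ n ≡ coeff (Δ (suc M) (κ 0)) n
  lemma 0                n≤ = count-Δ (λ xs → 0ℤ ℤ.≤? crank xs) n≤ λ xs _ _ → 0≤crank-κ xs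
  -- The partition 1 has crank -1, so the convention `C₁ 1 = 0` agrees with the count.
  lemma 1                n≤ = refl
  lemma n@(suc (suc _)) n≤ = count-Δ (λ xs → 0ℤ ℤ.≤? crank xs) n≤ λ xs _ _ → 0≤crank-κ xs

C₀≡D : ∀ {n} M → n ≤ suc M → C₀ n ≡ coeff (D (suc M)) n
C₀≡D {n} M n≤ = trans (lemma n n≤) (at (Δ-δ (suc M)) n)
  where
  lemma : ∀ n → n ≤ suc M → C₀ n ≡ coeff (Δ (suc M) δ) n
  lemma 0                n≤ = count-Δ (λ xs → 0ℤ ℤ.<? crank xs) n≤ λ xs → 0<crank-δ xs λ ()
  lemma 1                n≤ = refl
  lemma n@(suc (suc _)) n≤ = count-Δ (λ xs → 0ℤ ℤ.<? crank xs) n≤ λ xs → 0<crank-δ xs λ ()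

C₀≡ : ∀ {n} M → n ≤ suc M → C₀ n ≡ coeff (X 1 ⊛ K M 1) n
C₀≡ {n} M n≤ = trans (C₀≡D M n≤) (trans
  (sym (trans (cong (ℤ._+_ (coeff (D (suc M)) n)) (X-⊛-< (K M 1) (s≤s n≤))) (ℤ.+-identityʳ _)))
  (at (D-⊕-K M) n))

C₂≡C₁-C₀ : ∀ n → C₂ n ≡ C₁ n ℤ.- C₀ n
-- The conventions at 1 are consistent: -1 = 0 - 1.
C₂≡C₁-C₀ 1 = refl
C₂≡C₁-C₀ 0 = refl
C₂≡C₁-C₀ n@(suc (suc _)) = begin
  + count (λ xs → crank xs ℤ.≟ 0ℤ) (partitions n)                 ≡⟨ count-∑ (λ xs → crank xs ℤ.≟ 0ℤ) (partitions n) ⟩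
  ∑ (partitions n) zer
    ≡⟨ solve 2 (λ a b → a := b :+ a :- b) refl (∑ (partitions n) zer) (∑ (partitions n) pos) ⟩
  ∑ (partitions n) pos ℤ.+ ∑ (partitions n) zer ℤ.- ∑ (partitions n) pos
    ≡⟨ cong (ℤ._- ∑ (partitions n) pos) (sym (∑-+ (partitions n) pos zer)) ⟩
  ∑ (partitions n) (λ xs → pos xs ℤ.+ zer xs) ℤ.- ∑ (partitions n) pos
    ≡⟨ cong (ℤ._- ∑ (partitions n) pos) (∑-cong (partitions n) (λ xs _ → trichotomy (crank xs))) ⟩
  ∑ (partitions n) nonneg ℤ.- ∑ (partitions n) pos
    ≡⟨ cong₂ ℤ._-_ (count-∑ (λ xs → 0ℤ ℤ.≤? crank xs) (partitions n)) (count-∑ (λ xs → 0ℤ ℤ.<? crank xs) (partitions n)) ⟨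
  C₁ n ℤ.- C₀ n ∎
  where
  open ≡-Reasoning
  open +-*-Solver using (solve; _:=_; _:+_; _:-_)
  zer pos nonneg : List ℕ → ℤ
  zer    xs = ⟦ crank xs ℤ.≟ 0ℤ ⟧
  pos    xs = ⟦ 0ℤ ℤ.<? crank xs ⟧
  nonneg xs = ⟦ 0ℤ ℤ.≤? crank xs ⟧
  trichotomy : ∀ c → ⟦ 0ℤ ℤ.<? c ⟧ ℤ.+ ⟦ c ℤ.≟ 0ℤ ⟧ ≡ ⟦ 0ℤ ℤ.≤? c ⟧
  trichotomy (+ 0)       = refl
  trichotomy ℤ.+[1+ _ ]  = refl
  trichotomy ℤ.-[1+ _ ]  = refl

-- Partitions containing 1, …, k

ContainsUpTo⁻ : ∀ {k xs} → ContainsUpTo k xs → ∀ {j} → j < k → suc j ∈ xs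
ContainsUpTo⁻ c j<k = subst (λ i → suc i ∈ _) (Fin.toℕ-fromℕ< j<k) (c (fromℕ< j<k))

ContainsUpTo⁺ : ∀ {k xs} → (∀ {j} → j < k → suc j ∈ xs) → ContainsUpTo k xs
ContainsUpTo⁺ c i = c (Fin.toℕ<n i)

∈-tail : ∀ {x y} {xs : List ℕ} → y ∈ x ∷ xs → y ≢ x → y ∈ xs
∈-tail (here y≡x)   y≢x = contradiction y≡x y≢x
∈-tail (there y∈xs) _   = y∈xs

containsUpTo-larger : ∀ {k y} xs → k < y → ⟦ containsUpTo? k (y ∷ xs) ⟧ ≡ ⟦ containsUpTo? k xs ⟧
containsUpTo-larger {k} {y} xs k<y = ⟦⟧-cong (containsUpTo? k (y ∷ xs)) (containsUpTo? k xs)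
  (λ c → ContainsUpTo⁺ λ j<k → ∈-tail (ContainsUpTo⁻ c j<k) (ℕ.<⇒≢ (ℕ.≤-<-trans j<k k<y)))
  (λ c → there ∘ c)

containsUpTo-largest : ∀ m xs → ⟦ containsUpTo? (suc m) (suc m ∷ xs) ⟧ ≡ ⟦ containsUpTo? m xs ⟧
containsUpTo-largest m xs = ⟦⟧-cong (containsUpTo? (suc m) (suc m ∷ xs)) (containsUpTo? m xs)
  (λ c → ContainsUpTo⁺ λ j<m → ∈-tail (ContainsUpTo⁻ c (ℕ.m≤n⇒m≤1+n j<m)) (ℕ.<⇒≢ (s≤s j<m)))
  (λ c → ContainsUpTo⁺ λ {j} j≤m → to c j (j ≟ m) j≤m)
  where
  to : ContainsUpTo m xs → ∀ j → Dec (j ≡ m) → j < suc m → suc j ∈ suc m ∷ xs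
  to c j (yes refl) _   = here refl
  to c j (no j≢m)   j≤m = there (ContainsUpTo⁻ c (ℕ.≤∧≢⇒< (ℕ.≤-pred j≤m) j≢m))

-- One copy of each of 1, ..., k accounts for the exponent k(k+1)/2; what is left is an arbitrary
-- partition with parts at most `k`.
Δ-containsUpTo : ∀ k → Δ k (λ xs → ⟦ containsUpTo? k xs ⟧) ≈ X (triangular k) ⊛ p k
Δ-containsUpTo zero    = ≈-trans (Δ-zero _) (≈-sym (≈-trans (⊛-cong X-zero p-zero) (⊛-identityˡ 𝟙)))
Δ-containsUpTo (suc m) = ≈-trans
  (Δ-suc m {h = λ xs → ⟦ containsUpTo? m xs ⟧} λ xs _ _ → containsUpTo-largest m xs)
  (≈-trans (⊕-cong missing (⊛-congˡ {X (suc m)} extra))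
    (by-combination ((⊖ p (suc m)) · X-+ (suc m) (triangular m))
      (solve 4 (λ x t xt P → (con 0ℤ :+ x :* (t :* P)) :- xt :* P := :- P :* (xt :- x :* t))
        ≈-refl (X (suc m)) (X (triangular m)) (X (suc m ℕ.+ triangular m)) (p (suc m)))))
  where
  open SeriesSolver
  missing : Δ m (λ xs → ⟦ containsUpTo? (suc m) xs ⟧) ≈ 𝟘
  missing = ≈-trans (Δ-cong m λ xs _ dec → ⟦⟧-no (containsUpTo? (suc m) xs)
    (λ c → ℕ.1+n≰n (All.lookup (decreasing⇒bounded dec) (ContainsUpTo⁻ c ℕ.≤-refl)))) (Δ-𝟘 m)
  extra : Δ (suc m) (λ xs → ⟦ containsUpTo? m xs ⟧) ≈ X (triangular m) ⊛ p (suc m)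
  extra = fixpoint-unique m
    (≈-trans (Δ-suc m λ xs _ _ → containsUpTo-larger {m} xs ℕ.≤-refl) (⊕-congʳ (Δ-containsUpTo m)))
    (by-combination (X (triangular m) · p-suc m)
      (solve 4 (λ x t P P′ → t :* P′ :- (t :* P :+ x :* (t :* P′)) := t :* (P′ :- (P :+ x :* P′)))
        ≈-refl (X (suc m)) (X (triangular m)) (p m) (p (suc m))))

-- The repetition of the first part larger than k

occurrences-replicate : ∀ c x xs → occurrences x (replicate c x ++ xs) ≡ c ℕ.+ occurrences x xs
occurrences-replicate zero    x xs = refl
occurrences-replicate (suc c) x xs = trans
  (count-accept (_≟ x) x (replicate c x ++ xs) refl) (cong suc (occurrences-replicate c x xs))

occurrences-reject : ∀ {x y} xs → x ≢ y → occurrences y (x ∷ xs) ≡ occurrences y xs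
occurrences-reject {x} {y} xs x≢y = count-reject (_≟ y) x xs x≢y

occurrences-∷ : ∀ x y xs → occurrences y xs ≤ occurrences y (x ∷ xs)
occurrences-∷ x y xs with x ≟ y
... | yes refl = subst (occurrences y xs ≤_) (sym (count-accept (_≟ y) x xs refl)) (ℕ.n≤1+n _)
... | no  x≢y  = ℕ.≤-reflexive (sym (occurrences-reject xs x≢y))

occurrences⇒∈ : ∀ {c} x xs → suc c ≤ occurrences x xs → x ∈ xs
occurrences⇒∈ x (y ∷ xs) c≤ with y ≟ x
... | yes refl = here refl
... | no  y≢x  = there (occurrences⇒∈ x xs (subst (_ ≤_) (occurrences-reject xs y≢x) c≤))

occurrences-absent : ∀ {b xs} → All (_≤ b) xs → occurrences (suc b) xs ≡ 0
occurrences-absent {b} {xs} xs≤b = count-none (_≟ suc b) xs (All.map (λ { y≤b refl → ℕ.1+n≰n y≤b }) xs≤b)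

-- The part `y` keeps `x` from becoming a new smallest part above `k`. Only the multiplicity could
-- change, which is harmless if `x` is not the smallest such part or is already repeated often
-- enough.
firstLargerRepeats-∷ : ∀ {k x y} ys → y ∈ ys → k < y → y ≤ x → y < x ⊎ suc k ≤ occurrences x ys →
  ⟦ firstLargerRepeats? k (x ∷ ys) ⟧ ≡ ⟦ firstLargerRepeats? k ys ⟧
firstLargerRepeats-∷ {k} {x} {y} ys y∈ys k<y y≤x alt =
  ⟦⟧-cong (firstLargerRepeats? k (x ∷ ys)) (firstLargerRepeats? k ys) (to alt ∘ find) (from ∘ find)
  where
  LeastLarger : List ℕ → ℕ → Set
  LeastLarger xs q = k < q × All (λ r → k < r → q ≤ r) xs × suc k ≤ occurrences q xs
  to : y < x ⊎ suc k ≤ occurrences x ys → ∃ (λ q → q ∈ x ∷ ys × LeastLarger (x ∷ ys) q) → FirstLargerRepeats k ys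
  to alt (q , q∈ , k<q , _ ∷ q≤ , rep) with q ≟ x
  to alt        (q , q∈ , k<q , _ ∷ q≤ , rep) | no q≢x =
    lose (∈-tail q∈ q≢x) (k<q , q≤ , subst (suc k ≤_) (occurrences-reject ys (q≢x ∘ sym)) rep)
  to (inj₁ y<x) (q , q∈ , k<q , _ ∷ q≤ , rep) | yes refl = contradiction (All.lookup q≤ y∈ys k<y) (ℕ.<⇒≱ y<x)
  to (inj₂ occ) (q , q∈ , k<q , _ ∷ q≤ , rep) | yes refl = lose (occurrences⇒∈ x ys occ) (k<q , q≤ , occ)
  from : ∃ (λ q → q ∈ ys × LeastLarger ys q) → FirstLargerRepeats k (x ∷ ys)
  from (q , q∈ , k<q , q≤ , rep) =
    there (lose q∈ (k<q , (λ _ → ℕ.≤-trans (All.lookup q≤ y∈ys k<y) y≤x) ∷ q≤ , ℕ.≤-trans rep (occurrences-∷ x q ys)))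

module FirstLarger (k : ℕ) where
  open SeriesSolver

  -- The indicator of the partitions counted by P̃ k, read after c copies of a part x > k.
  β : ℕ → ℕ → Weight
  β c x xs = ⟦ containsUpTo? k xs ⟧ ℤ.* ⟦ firstLargerRepeats? k (replicate c x ++ xs) ⟧

  -- A smaller part above `k` supersedes `x` as candidate for the first larger part, and the count
  -- restarts at 1.
  β-smaller : ∀ c {x y} xs → k < y → y < x → β c x (y ∷ xs) ≡ β 1 y xs
  β-smaller c {x} {y} xs k<y y<x = cong₂ ℤ._*_ (containsUpTo-larger xs k<y) (drop-replicate c)
    where
    drop-replicate : ∀ c → ⟦ firstLargerRepeats? k (replicate c x ++ y ∷ xs) ⟧ ≡ ⟦ firstLargerRepeats? k (y ∷ xs) ⟧
    drop-replicate zero    = refl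
    drop-replicate (suc c) = trans
      (firstLargerRepeats-∷ (replicate c x ++ y ∷ xs) (y∈ c) k<y (ℕ.<⇒≤ y<x) (inj₁ y<x))
      (drop-replicate c)
      where
      y∈ : ∀ c → y ∈ replicate c x ++ y ∷ xs
      y∈ zero    = here refl
      y∈ (suc c) = there (y∈ c)

  β-same : ∀ c {x} xs → k < x → β c x (x ∷ xs) ≡ β (suc c) x xs
  β-same c {x} xs k<x = cong₂ ℤ._*_ (containsUpTo-larger xs k<x)
    (cong (λ ys → ⟦ firstLargerRepeats? k ys ⟧) (replicate-∷ c))
    where
    replicate-∷ : ∀ c → replicate c x ++ x ∷ xs ≡ x ∷ replicate c x ++ xs
    replicate-∷ zero    = refl
    replicate-∷ (suc c) = cong (x ∷_) (replicate-∷ c)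

  -- After k + 1 copies the requirement on `x` is met, so the counter may stop. This closes the
  -- recurrence in `top`.
  β-saturated : ∀ {x} xs → k < x → β (suc (suc k)) x xs ≡ β (suc k) x xs
  β-saturated {x} xs k<x = cong (⟦ containsUpTo? k xs ⟧ ℤ.*_)
    (firstLargerRepeats-∷ (replicate (suc k) x ++ xs) (here refl) k<x ℕ.≤-refl
      (inj₂ (subst (suc k ≤_) (sym (occurrences-replicate (suc k) x xs)) (ℕ.m≤m+n (suc k) _))))

  β-repeated : ∀ {x xs} → k < x → All (_≤ k) xs → β (suc k) x xs ≡ ⟦ containsUpTo? k xs ⟧
  β-repeated {x} {xs} k<x xs≤k = trans
    (cong (⟦ containsUpTo? k xs ⟧ ℤ.*_) (⟦⟧-yes (firstLargerRepeats? k (replicate (suc k) x ++ xs))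
      (here (k<x
        , All.++⁺ {xs = replicate (suc k) x} (All.replicate⁺ (suc k) (λ _ → ℕ.≤-refl))
            (All.map (λ r≤k k<r → contradiction r≤k (ℕ.<⇒≱ k<r)) xs≤k)
        , subst (suc k ≤_) (sym (occurrences-replicate (suc k) x xs)) (ℕ.m≤m+n (suc k) _)))))
    (ℤ.*-identityʳ _)

  β-unrepeated : ∀ {c x xs} → c ≤ k → k < x → All (_≤ k) xs → β c x xs ≡ 0ℤ
  β-unrepeated {c} {x} {xs} c≤k k<x xs≤k = trans
    (cong (⟦ containsUpTo? k xs ⟧ ℤ.*_) (⟦⟧-no (firstLargerRepeats? k (replicate c x ++ xs)) (impossible ∘ find)))
    (ℤ.*-zeroʳ ⟦ containsUpTo? k xs ⟧)
    where
    large : ∀ c {q} → q ∈ replicate c x ++ xs → k < q → q ≡ x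
    large zero    q∈         k<q = contradiction (All.lookup xs≤k q∈) (ℕ.<⇒≱ k<q)
    large (suc c) (here q≡x) k<q = q≡x
    large (suc c) (there q∈) k<q = large c q∈ k<q
    impossible : ¬ ∃ (λ q → q ∈ replicate c x ++ xs ×
      k < q × All (λ r → k < r → q ≤ r) (replicate c x ++ xs) × suc k ≤ occurrences q (replicate c x ++ xs))
    impossible (q , q∈ , k<q , _ , rep) with refl ← large c q∈ k<q = ℕ.<⇒≱ rep
      (subst (_≤ k) (sym (trans (occurrences-replicate c x xs)
        (trans (cong (c ℕ.+_) (count-none (_≟ x) xs (All.map (λ { r≤k refl → ℕ.<⇒≱ k<x r≤k }) xs≤k))) (ℕ.+-identityʳ c)))) c≤k)

  -- Nothing has been read yet: with zero copies the second argument of `β` is a dummy.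
  B : ℕ → Series
  B m = Δ m (β 0 0)

  E : Series
  E = X (triangular k) ⊛ p k

  B-start : B k ≈ 𝟘
  B-start = ≈-trans (Δ-cong k λ xs _ dec → β-unrepeated {0} {suc k} z≤n ℕ.≤-refl (decreasing⇒bounded dec)) (Δ-𝟘 k)

  private
    -- Below `x`, either no further part exceeds `k`, which contributes `e`, or some part in between
    -- does, and then the copies of `x` no longer matter.
    below : ∀ {c x e} → Δ k (β c x) ≈ e → ∀ d → d ℕ.+ k < x → Δ (d ℕ.+ k) (β c x) ≈ B (d ℕ.+ k) ⊕ e
    below {e = e} base zero    _  = ≈-trans base (≈-sym (≈-trans (⊕-congʳ B-start) (⊕-identityˡ e)))
    below {c} {x} {e} base (suc d) d< = ≈-trans
      (≈-trans (Δ-suc (d ℕ.+ k) λ xs _ _ → β-smaller c xs k<1+d+k d<) (⊕-congʳ (below {c} {x} base d (ℕ.<-trans ℕ.≤-refl d<))))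
      (≈-trans
        (solve 3 (λ b e t → (b :+ e) :+ t := (b :+ t) :+ e) ≈-refl
          (B (d ℕ.+ k)) e (X (suc (d ℕ.+ k)) ⊛ Δ (suc (d ℕ.+ k)) (β 1 (suc (d ℕ.+ k)))))
        (⊕-congʳ (≈-sym (Δ-suc (d ℕ.+ k) λ xs _ _ →
          cong (ℤ._* ⟦ firstLargerRepeats? k (suc (d ℕ.+ k) ∷ xs) ⟧) (containsUpTo-larger xs k<1+d+k)))))
      where
      k<1+d+k : k < suc (d ℕ.+ k)
      k<1+d+k = s≤s (ℕ.m≤n+m k d)

    -- Here `r` is the number of copies of `suc m` still missing from k + 1. Each missing copy
    -- multiplies the successful term `E` by one more factor q^{m+1}; at r = 0 the weight reproduces
    -- itself.
    top : ∀ d r c → r ℕ.+ c ≡ suc k → let m = d ℕ.+ k in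
          Δ (suc m) (β c (suc m)) ≈ (B m ⊕ X (r ℕ.* suc m) ⊛ E) ⊕ X (suc m) ⊛ Δ (suc m) (β c (suc m))
    top d zero .(suc k) refl = ≈-trans
      (Δ-suc (d ℕ.+ k) λ xs _ _ → trans (β-same (suc k) xs k<m) (β-saturated xs k<m))
      (⊕-congʳ (≈-trans
        (below {suc k} {suc (d ℕ.+ k)}
          (≈-trans (Δ-cong k λ xs _ dec → β-repeated {suc (d ℕ.+ k)} {xs} k<m (decreasing⇒bounded dec)) (Δ-containsUpTo k))
          d ℕ.≤-refl)
        (⊕-congˡ (≈-sym (≈-trans (⊛-congʳ {E} X-zero) (⊛-identityˡ E))))))
      where
      k<m : k < suc (d ℕ.+ k)
      k<m = s≤s (ℕ.m≤n+m k d)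
    top d (suc r) c r+c≡ = by-combination
      ((𝟙 ⊕ ⊖ z) · step ⊞ z · top d r (suc c) (trans (ℕ.+-suc r c) r+c≡) ⊞ (⊖ E) · X-+ (suc m) (r ℕ.* suc m))
      (solve 7 (λ T T′ b z x x′ e →
          T :- ((b :+ x′ :* e) :+ z :* T) :=
          (:1 :- z) :* (T :- (b :+ z :* T′)) :+ (z :* (T′ :- ((b :+ x :* e) :+ z :* T′)) :+ :- e :* (x′ :- z :* x)))
        ≈-refl (Δ (suc m) (β c (suc m))) (Δ (suc m) (β (suc c) (suc m))) (B m) z (X (r ℕ.* suc m)) (X (suc r ℕ.* suc m)) E)
      where
      m = d ℕ.+ k
      z = X (suc m)
      k<m : k < suc m
      k<m = s≤s (ℕ.m≤n+m k d)
      c≤k : c ≤ k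
      c≤k = ℕ.≤-trans (ℕ.m≤n+m c r) (ℕ.≤-reflexive (ℕ.suc-injective r+c≡))
      step : Δ (suc m) (β c (suc m)) ≈ B m ⊕ z ⊛ Δ (suc m) (β (suc c) (suc m))
      step = ≈-trans (Δ-suc m λ xs _ _ → β-same c xs k<m)
        (⊕-congʳ (≈-trans
          (below {c} {suc m}
            (≈-trans (Δ-cong k λ xs _ dec → β-unrepeated {c} {suc m} {xs} c≤k k<m (decreasing⇒bounded dec)) (Δ-𝟘 k))
            d ℕ.≤-refl)
          (⊕-identityʳ (B m))))

  B-suc : ∀ {m} → k ≤ m → B (suc m) ≈ B m ⊕ X (suc k ℕ.* suc m) ⊛ E ⊕ X (suc m) ⊛ B (suc m)
  B-suc {m} k≤m = subst (λ m → B (suc m) ≈ B m ⊕ X (suc k ℕ.* suc m) ⊛ E ⊕ X (suc m) ⊛ B (suc m))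
    -- All k + 1 copies are missing at the start, and `β 0 (suc m)` is by computation the weight of
    -- `B`.
    (ℕ.m∸n+n≡m k≤m) (top (m ℕ.∸ k) (suc k) 0 (ℕ.+-identityʳ (suc k)))

P̃≡ : ∀ k {m n} → n ≤ m → + P̃ k n ≡ coeff (FirstLarger.B k m) n
P̃≡ k n≤m = count-Δ (λ xs → containsUpTo? k xs ×-dec firstLargerRepeats? k xs) n≤m
  λ xs _ _ → ⟦⟧-× (containsUpTo? k xs) (firstLargerRepeats? k xs)

-- Unimodal compositions

unimodal-∷⁻ : ∀ {x y ys} → IsUnimodal (x ∷ y ∷ ys) → (x ≤ y × IsUnimodal (y ∷ ys)) ⊎ IsWeaklyDecreasing (x ∷ y ∷ ys)
unimodal-∷⁻ (Fin.zero , _ , dec)          = inj₂ dec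
unimodal-∷⁻ (Fin.suc t , x≤y ∷ asc , dec) = inj₁ (x≤y , t , asc , dec)

unimodal-∷⁺ : ∀ {x y ys} → x ≤ y → IsUnimodal (y ∷ ys) → IsUnimodal (x ∷ y ∷ ys)
unimodal-∷⁺ x≤y (t , asc , dec) = Fin.suc t , x≤y ∷ asc , dec

decreasing⇒unimodal : ∀ {x xs} → IsWeaklyDecreasing (x ∷ xs) → IsUnimodal (x ∷ xs)
decreasing⇒unimodal dec = Fin.zero , [-] , dec

unimodal⇒decreasing : ∀ {x xs} → All (_≤ x) xs → IsUnimodal (x ∷ xs) → IsWeaklyDecreasing (x ∷ xs)
unimodal⇒decreasing []             _ = [-]
unimodal⇒decreasing (y≤x ∷ ys≤x) uni with unimodal-∷⁻ uni
... | inj₂ dec        = dec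
... | inj₁ (x≤y , uni′) with refl ← ℕ.≤-antisym x≤y y≤x = y≤x ∷ unimodal⇒decreasing ys≤x uni′

maxPart-bound : ∀ {a xs} → maxPart xs ≡ a → All (_≤ a) xs
maxPart-bound {xs = xs} refl = xs≤max 0 xs

maxPart-∈ : ∀ {b} xs → maxPart xs ≡ suc b → suc b ∈ xs
maxPart-∈ xs eq with argmax-sel id 0 xs
... | inj₁ max≡0  = contradiction (trans (sym max≡0) eq) λ ()
... | inj₂ max∈xs = subst (_∈ xs) eq max∈xs

maxPart≡ : ∀ {a xs} → a ∈ xs → All (_≤ a) xs → maxPart xs ≡ a
maxPart≡ a∈xs xs≤a = max≈v⁺ a∈xs xs≤a z≤n

maxPart-∷⁻ : ∀ {x b} xs → x < suc b → maxPart (x ∷ xs) ≡ suc b → maxPart xs ≡ suc b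
maxPart-∷⁻ {x} xs x<a eq = maxPart≡
  (∈-tail (maxPart-∈ (x ∷ xs) eq) (ℕ.<⇒≢ x<a ∘ sym))
  (All.tail (maxPart-bound {xs = x ∷ xs} eq))

maxPart-∷⁺ : ∀ {x b} xs → x < suc b → maxPart xs ≡ suc b → maxPart (x ∷ xs) ≡ suc b
maxPart-∷⁺ {x} xs x<a eq = maxPart≡ (there (maxPart-∈ xs eq)) (ℕ.<⇒≤ x<a ∷ maxPart-bound {xs = xs} eq)

all≤sum : ∀ xs → All (_≤ sum xs) xs
all≤sum []       = []
all≤sum (x ∷ xs) = ℕ.m≤m+n x (sum xs) ∷ All.map (λ y≤ → ℕ.≤-trans y≤ (ℕ.m≤n+m (sum xs) x)) (all≤sum xs)

-- `R` is the condition on the multiplicity of the maximal part, so that one decomposition serves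
-- `u 0` as well as `u 1` and `u 2`.
module Peak {R : Pred ℕ 0ℓ} (R? : Decidable R) where

  HasPeak : ℕ → List ℕ → Set
  HasPeak a xs = IsUnimodal xs × maxPart xs ≡ a × R (occurrences a xs)

  hasPeak? : ∀ a → Decidable (HasPeak a)
  hasPeak? a xs = isUnimodal? xs ×-dec (maxPart xs ≟ a) ×-dec R? (occurrences a xs)

  -- The indicator of HasPeak a among the compositions with first part at least x.
  ascending : ℕ → ℕ → Weight
  ascending a x []       = 0ℤ
  ascending a x (y ∷ ys) = ⟦ (x ≤? y) ×-dec hasPeak? a (y ∷ ys) ⟧

  -- If the first part is already maximal, unimodality means weakly decreasing: the left arm is
  -- empty.
  Φ-peak : ∀ b → Φ (ascending (suc b) (suc b)) ≈ X (suc b) ⊛ Δ (suc b) (λ xs → ⟦ R? (suc (occurrences (suc b) xs)) ⟧)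
  Φ-peak b = ≈-trans
    (Φ-split b {g = λ _ → 0ℤ} {h = λ xs → ⟦ isWeaklyDecreasing? (a ∷ xs) ⟧ ℤ.* ⟦ R? (suc (occurrences a xs)) ⟧} refl
      (λ y ys _ y≢a → ⟦⟧-no ((a ≤? y) ×-dec hasPeak? a (y ∷ ys))
        λ { (a≤y , _ , max≡a , _) → y≢a (ℕ.≤-antisym (All.head (maxPart-bound {xs = y ∷ ys} max≡a)) a≤y) })
      (λ _ → refl)
      (λ xs _ → trans
        (⟦⟧-cong ((a ≤? a) ×-dec hasPeak? a (a ∷ xs)) (isWeaklyDecreasing? (a ∷ xs) ×-dec R? (suc (occurrences a xs)))
          (λ { (_ , uni , max≡a , r) → unimodal⇒decreasing (All.tail (maxPart-bound {xs = a ∷ xs} max≡a)) uni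
                                     , subst R (count-accept (_≟ a) a xs refl) r })
          (λ { (dec , r) → ℕ.≤-refl , decreasing⇒unimodal dec
                         , maxPart≡ (here refl) (ℕ.≤-refl ∷ decreasing⇒bounded dec)
                         , subst R (sym (count-accept (_≟ a) a xs refl)) r }))
        (⟦⟧-× (isWeaklyDecreasing? (a ∷ xs)) (R? (suc (occurrences a xs))))))
    (≈-trans (⊕-cong (Φ-zero λ _ _ → refl) (⊛-congˡ {X a} (≈-sym (Δ-Φ a _)))) (⊕-identityˡ _))
    where a = suc b

  ascending-∷ : ∀ {x b} xs → x < suc b → ⟦ (x ≤? x) ×-dec hasPeak? (suc b) (x ∷ xs) ⟧ ≡ ascending (suc b) x xs
  ascending-∷ {x} {b} [] x<a = ⟦⟧-no ((x ≤? x) ×-dec hasPeak? (suc b) (x ∷ []))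
    λ { (_ , _ , max≡a , _) → contradiction (∈-tail (maxPart-∈ (x ∷ []) max≡a) (ℕ.<⇒≢ x<a ∘ sym)) λ () }
  ascending-∷ {x} {b} xs@(y ∷ ys) x<a = ⟦⟧-cong ((x ≤? x) ×-dec hasPeak? a (x ∷ xs)) ((x ≤? y) ×-dec hasPeak? a xs)
    (λ { (_ , uni , max≡a , r) → to max≡a (unimodal-∷⁻ uni) (subst R (occurrences-reject xs (ℕ.<⇒≢ x<a)) r) })
    (λ { (x≤y , uni , max≡a , r) → ℕ.≤-refl , unimodal-∷⁺ x≤y uni , maxPart-∷⁺ xs x<a max≡a
                                 , subst R (sym (occurrences-reject xs (ℕ.<⇒≢ x<a))) r })
    where
    a = suc b
    to : maxPart (x ∷ xs) ≡ a → (x ≤ y × IsUnimodal xs) ⊎ IsWeaklyDecreasing (x ∷ xs) → R (occurrences a xs) →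
         x ≤ y × HasPeak a xs
    to max≡a (inj₁ (x≤y , uni)) r = x≤y , uni , maxPart-∷⁻ xs x<a max≡a , r
    to max≡a (inj₂ dec)         r = contradiction
      (All.lookup (ℕ.≤-refl ∷ decreasing⇒bounded dec) (maxPart-∈ (x ∷ xs) max≡a)) (ℕ.<⇒≱ x<a)

  -- Deleting a first part below the peak changes neither the peak nor its multiplicity. Hence
  -- raising the least admissible first part from i + 1 to i + 2 multiplies the series by 1 -
  -- q^{i+1}.
  Φ-ascending : ∀ b i → i ≤ b → Φ (ascending (suc b) (suc i)) ≈ Φ (ascending (suc b) 1) ⊛ poch i
  Φ-ascending b zero    _   = ≈-sym (⊛-identityʳ _)
  Φ-ascending b (suc i) i<b = by-combination ((⊖ 𝟙) · split ⊞ (𝟙 ⊕ ⊖ X (suc i)) · Φ-ascending b i (ℕ.<⇒≤ i<b))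
    (solve 5 (λ f f′ g c x → f′ :- g :* (c :* (:1 :- x)) := :- :1 :* (f :- (f′ :+ x :* f)) :+ (:1 :- x) :* (f :- g :* c))
      ≈-refl (Φ (ascending a (suc i))) (Φ (ascending a (suc (suc i)))) (Φ (ascending a 1)) (poch i) (X (suc i)))
    where
    open SeriesSolver
    a = suc b
    split : Φ (ascending a (suc i)) ≈ Φ (ascending a (suc (suc i))) ⊕ X (suc i) ⊛ Φ (ascending a (suc i))
    split = Φ-split i refl
      (λ y ys _ y≢ → ⟦⟧-cong ((suc i ≤? y) ×-dec hasPeak? a (y ∷ ys)) ((suc (suc i) ≤? y) ×-dec hasPeak? a (y ∷ ys))
        (λ { (i≤y , rest) → ℕ.≤∧≢⇒< i≤y (y≢ ∘ sym) , rest }) (λ { (i<y , rest) → ℕ.<⇒≤ i<y , rest }))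
      (λ ys → ⟦⟧-no ((suc (suc i) ≤? suc i) ×-dec hasPeak? a (suc i ∷ ys)) (ℕ.1+n≰n ∘ proj₁))
      (λ xs _ → ascending-∷ xs (s≤s i<b))

  -- The cut is made at the first occurrence of the maximum, which makes it unique: parts before it
  -- are at most `b`, parts after it may equal `suc b`. The added `suc` in the argument of `R`
  -- counts the peak itself.
  Φ-hasPeak : ∀ b → Φ (λ xs → ⟦ hasPeak? (suc b) xs ⟧)
                    ≈ X (suc b) ⊛ Δ (suc b) (λ xs → ⟦ R? (suc (occurrences (suc b) xs)) ⟧) ⊛ p b
  Φ-hasPeak b = ≈-trans (Φ-cong start) (by-combination
    ((⊖ Φ (ascending (suc b) 1)) · poch-⊛-p b ⊞ (⊖ p b) · Φ-ascending b b ℕ.≤-refl ⊞ p b · Φ-peak b)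
    (solve 5 (λ f f′ c P g → f :- g :* P := :- f :* (c :* P :- :1) :+ (:- P :* (f′ :- f :* c) :+ P :* (f′ :- g)))
      ≈-refl (Φ (ascending (suc b) 1)) (Φ (ascending (suc b) (suc b))) (poch b) (p b)
      (X (suc b) ⊛ Δ (suc b) (λ xs → ⟦ R? (suc (occurrences (suc b) xs)) ⟧))))
    where
    open SeriesSolver
    start : ∀ xs → All (1 ≤_) xs → ⟦ hasPeak? (suc b) xs ⟧ ≡ ascending (suc b) 1 xs
    start []       _         = refl
    start (x ∷ xs) (1≤x ∷ _) = ⟦⟧-cong (hasPeak? (suc b) (x ∷ xs)) ((1 ≤? x) ×-dec hasPeak? (suc b) (x ∷ xs)) (1≤x ,_) proj₂

  V : ℕ → Series
  V zero    = 𝟘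
  V (suc b) = V b ⊕ X (suc b) ⊛ Δ (suc b) (λ xs → ⟦ R? (suc (occurrences (suc b) xs)) ⟧) ⊛ p b

  count-V : ∀ {n M} {P : Pred (List ℕ) 0ℓ} (P? : Decidable P) → n ≤ M →
            (∀ xs → P xs → IsUnimodal xs × R (occurrences (maxPart xs) xs)) →
            (∀ xs → IsUnimodal xs → R (occurrences (maxPart xs) xs) → P xs) →
            + count P? (compositions n) ≡ coeff (V M) n
  count-V {n} {M} P? n≤M to from = trans (count-∑ P? (compositions n)) (trans
    (Φ-cong-at n λ xs c → ⟦⟧-cong (P? xs) (bounded? M xs)
      (λ px → proj₁ (to xs px)
            , max≤v⁺ z≤n (All.map (λ x≤ → ℕ.≤-trans x≤ (ℕ.≤-trans (ℕ.≤-reflexive (proj₂ c)) n≤M)) (all≤sum xs))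
            , proj₂ (to xs px))
      (λ { (uni , _ , r) → from xs uni r }))
    (at (Φ-bounded M) n))
    where
    bounded? : ∀ M → Decidable (λ xs → IsUnimodal xs × maxPart xs ≤ M × R (occurrences (maxPart xs) xs))
    bounded? M xs = isUnimodal? xs ×-dec (maxPart xs ≤? M) ×-dec R? (occurrences (maxPart xs) xs)
    Φ-bounded : ∀ M → Φ (λ xs → ⟦ bounded? M xs ⟧) ≈ V M
    Φ-bounded zero    = Φ-zero λ
      { []       _         → refl
      ; (x ∷ xs) (1≤x ∷ _) → ⟦⟧-no (bounded? 0 (x ∷ xs)) λ { (_ , max≤0 , _) →
          ℕ.<⇒≱ 1≤x (ℕ.≤-trans (All.head (xs≤max 0 (x ∷ xs))) max≤0) } }
    Φ-bounded (suc M) = ≈-trans (Φ-cong λ xs _ → pointwise xs (maxPart xs ≟ suc M))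
      (≈-trans (Φ-⊕ _ _) (⊕-cong (Φ-bounded M) (Φ-hasPeak M)))
      where
      pointwise : ∀ xs → Dec (maxPart xs ≡ suc M) → ⟦ bounded? (suc M) xs ⟧ ≡ ⟦ bounded? M xs ⟧ ℤ.+ ⟦ hasPeak? (suc M) xs ⟧
      pointwise xs (yes max≡) = trans
        (⟦⟧-cong (bounded? (suc M) xs) (hasPeak? (suc M) xs)
          (λ { (uni , _ , r) → uni , max≡ , subst (λ a → R (occurrences a xs)) max≡ r })
          (λ { (uni , _ , r) → uni , ℕ.≤-reflexive max≡ , subst (λ a → R (occurrences a xs)) (sym max≡) r }))
        (sym (trans (cong (ℤ._+ ⟦ hasPeak? (suc M) xs ⟧) (⟦⟧-no (bounded? M xs)
          (λ { (_ , max≤ , _) → ℕ.1+n≰n (subst (_≤ M) max≡ max≤) }))) (ℤ.+-identityˡ _)))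
      pointwise xs (no max≢) = trans
        (⟦⟧-cong (bounded? (suc M) xs) (bounded? M xs)
          (λ { (uni , max≤ , r) → uni , ℕ.≤-pred (ℕ.≤∧≢⇒< max≤ max≢) , r })
          (λ { (uni , max≤ , r) → uni , ℕ.m≤n⇒m≤1+n max≤ , r }))
        (sym (trans (cong (ℤ._+_ ⟦ bounded? M xs ⟧) (⟦⟧-no (hasPeak? (suc M) xs) (max≢ ∘ proj₁ ∘ proj₂))) (ℤ.+-identityʳ _)))

-- Unimodal compositions by the multiplicity of the maximal part

module AnyMultiplicity     = Peak {R = λ _ → ⊤} (λ _ → yes tt)
module Multiplicity (m : ℕ) = Peak {R = _≡ m} (_≟ m)

u₀-V : ∀ {n M} → n ≤ M → + u 0 n ≡ coeff (AnyMultiplicity.V M) n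
-- The convention `u 0 0 = 0` agrees with the count, since the empty list has no peak index.
u₀-V {zero}      n≤M = AnyMultiplicity.count-V {0} isUnimodal? n≤M (λ _ uni → uni , tt) (λ _ uni _ → uni)
u₀-V {n@(suc _)} n≤M = AnyMultiplicity.count-V {n} isUnimodal? n≤M (λ _ uni → uni , tt) (λ _ uni _ → uni)

u-V : ∀ m {n M} → n ℕ.+ suc m ≤ M → + u (suc m) n ≡ coeff (Multiplicity.V (suc m) M) (n ℕ.+ suc m)
u-V m n≤M = Multiplicity.count-V (suc m) (λ xs → isUnimodal? xs ×-dec maxAppears? (suc m) xs) n≤M
  (λ _ uni×max → uni×max) (λ _ uni max → uni , max)

-- A peak b + 1 of any multiplicity contributes q^{b+1} / ((q)_b (q)_{b+1}), which is q times the
-- term i = b of `L M 1`.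
V₀≈L : ∀ M → AnyMultiplicity.V (suc M) ≈ X 1 ⊛ L M 1
V₀≈L zero    = by-combination ((X 1 ⊛ p 1) · p-zero)
  (solve 3 (λ q P P′ → (con 0ℤ :+ q :* P′ :* P) :- q :* P′ := q :* P′ :* (P :- :1)) ≈-refl (X 1) (p 0) (p 1))
  where open SeriesSolver
V₀≈L (suc t) = by-combination
  (𝟙 · V₀≈L t ⊞ (p (suc (suc t)) ⊛ p (suc t)) · X-+ 1 (suc t)
    ⊞ (X 1 ⊛ X (suc t) ⊛ p (suc t)) · ≈-reflexive (cong (λ i → p (suc i)) (ℕ.+-comm 1 t)))
  (solve 8 (λ v l q x x′ P P′ P″ →
      (v :+ x′ :* P′ :* P) :- q :* (l :+ x :* P :* P″) :=
      :1 :* (v :- q :* l) :+ (P′ :* P :* (x′ :- q :* x) :+ q :* x :* P :* (P′ :- P″)))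
    ≈-refl (AnyMultiplicity.V (suc t)) (L t 1) (X 1) (X (suc t)) (X (suc (suc t))) (p (suc t)) (p (suc (suc t))) (p (suc t ℕ.+ 1)))
  where open SeriesSolver

Δ-once : ∀ b → Δ (suc b) (λ xs → ⟦ suc (occurrences (suc b) xs) ≟ 1 ⟧) ≈ p b
Δ-once b = ≈-trans
  (Δ-suc b {h = λ _ → 0ℤ} λ xs _ _ → ⟦⟧-no (suc (occurrences a (a ∷ xs)) ≟ 1) λ eq →
    contradiction (trans (sym (count-accept (_≟ a) a xs refl)) (ℕ.suc-injective eq)) λ ())
  (≈-trans (⊕-cong
      (Δ-cong b λ xs _ dec → ⟦⟧-yes (suc (occurrences a xs) ≟ 1) (cong suc (occurrences-absent (decreasing⇒bounded dec))))
      (≈-trans (⊛-congˡ {X a} (Δ-𝟘 a)) (⊛-zeroʳ (X a))))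
    (⊕-identityʳ (p b)))
  where
  a = suc b

Δ-twice : ∀ b → Δ (suc b) (λ xs → ⟦ suc (occurrences (suc b) xs) ≟ 2 ⟧) ≈ X (suc b) ⊛ p b
Δ-twice b = ≈-trans
  (Δ-suc b λ xs _ _ → ⟦⟧-cong (suc (occurrences a (a ∷ xs)) ≟ 2) (suc (occurrences a xs) ≟ 1)
    (λ eq → trans (sym (count-accept (_≟ a) a xs refl)) (ℕ.suc-injective eq))
    (λ eq → cong suc (trans (count-accept (_≟ a) a xs refl) eq)))
  (≈-trans (⊕-cong
      (≈-trans (Δ-cong b λ xs _ dec → ⟦⟧-no (suc (occurrences a xs) ≟ 2) λ eq →
        contradiction (trans (sym (occurrences-absent (decreasing⇒bounded dec))) (ℕ.suc-injective eq)) λ ()) (Δ-𝟘 b))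
      (⊛-congˡ {X a} (Δ-once b)))
    (⊕-identityˡ _))
  where
  a = suc b

V₁≈L : ∀ M → Multiplicity.V 1 (suc M) ≈ X 1 ⊛ L M 0
V₁≈L zero    = by-combination ((X 1 ⊛ p 0) · Δ-once 0 ⊞ (X 1 ⊛ p 0) · p-zero)
  (solve 3 (λ q P d → (con 0ℤ :+ q :* d :* P) :- q :* P := q :* P :* (d :- P) :+ q :* P :* (P :- :1))
    ≈-refl (X 1) (p 0) (Δ 1 (λ xs → ⟦ suc (occurrences 1 xs) ≟ 1 ⟧)))
  where open SeriesSolver
V₁≈L (suc t) = by-combination
  (𝟙 · V₁≈L t ⊞ (X (suc (suc t)) ⊛ p (suc t)) · Δ-once (suc t) ⊞ (p (suc t) ⊛ p (suc t)) · X-+ 1 (suc t)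
    ⊞ (X 1 ⊛ X (suc t) ⊛ p (suc t)) · ≈-reflexive (cong (λ i → p (suc i)) (sym (ℕ.+-identityʳ t))))
  (solve 8 (λ v l q x x′ P P″ d →
      (v :+ x′ :* d :* P) :- q :* (l :+ x :* P :* P″) :=
      :1 :* (v :- q :* l) :+ (x′ :* P :* (d :- P) :+ (P :* P :* (x′ :- q :* x) :+ q :* x :* P :* (P :- P″))))
    ≈-refl (Multiplicity.V 1 (suc t)) (L t 0) (X 1) (X (suc t)) (X (suc (suc t))) (p (suc t)) (p (suc t ℕ.+ 0))
      (Δ (suc (suc t)) (λ xs → ⟦ suc (occurrences (suc (suc t)) xs) ≟ 1 ⟧)))
  where open SeriesSolver

-- A peak b + 1 occurring twice gives q^{2b+2}/(q)_b². Up to q² this is q^b/(q)_b² - q^b/((q)_b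
-- (q)_{b-1}) for b ≥ 1, because 1/(q)_{b-1} = (1 - q^b)/(q)_b; hence the difference of `L M 0` and
-- the series for `u 0`.
V₂≈ : ∀ M → Multiplicity.V 2 (suc M) ≈ X 2 ⊛ (L M 0 ⊕ ⊖ AnyMultiplicity.V M)
V₂≈ zero    = by-combination ((X 1 ⊛ p 0) · Δ-twice 0 ⊞ (X 1 ⊛ X 1 ⊛ p 0) · p-zero ⊞ (⊖ p 0) · X-+ 1 1)
  (solve 4 (λ q q² P d → (con 0ℤ :+ q :* d :* P) :- q² :* (P :- con 0ℤ) :=
      q :* P :* (d :- q :* P) :+ (q :* q :* P :* (P :- :1) :+ :- P :* (q² :- q :* q)))
    ≈-refl (X 1) (X 2) (p 0) (Δ 1 (λ xs → ⟦ suc (occurrences 1 xs) ≟ 2 ⟧)))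
  where open SeriesSolver
V₂≈ (suc t) = by-combination
  (𝟙 · V₂≈ t ⊞ (x′ ⊛ p (suc t)) · Δ-twice (suc t)
    ⊞ (p (suc t) ⊛ p (suc t) ⊛ (x′ ⊕ X 1 ⊛ X (suc t))) · X-+ 1 (suc t)
    ⊞ (⊖ (X (suc t) ⊛ X (suc t) ⊛ p (suc t) ⊛ p (suc t))) · X-+ 1 1
    ⊞ (⊖ (X 2 ⊛ X (suc t) ⊛ p (suc t))) · p-suc t
    ⊞ (X 2 ⊛ X (suc t) ⊛ p (suc t)) · ≈-reflexive (cong (λ i → p (suc i)) (sym (ℕ.+-identityʳ t))))
  (solve 11 (λ v l w q q² x x′ P P⁻ P″ d →
      (v :+ x′ :* d :* P) :- q² :* ((l :+ x :* P :* P″) :- (w :+ x :* P :* P⁻)) :=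
      :1 :* (v :- q² :* (l :- w)) :+ (x′ :* P :* (d :- x′ :* P) :+ (P :* P :* (x′ :+ q :* x) :* (x′ :- q :* x)
        :+ (:- (x :* x :* P :* P) :* (q² :- q :* q) :+ (:- (q² :* x :* P) :* (P :- (P⁻ :+ x :* P)) :+ q² :* x :* P :* (P :- P″))))))
    ≈-refl (Multiplicity.V 2 (suc t)) (L t 0) (AnyMultiplicity.V t) (X 1) (X 2) (X (suc t)) x′ (p (suc t)) (p t) (p (suc t ℕ.+ 0))
      (Δ (suc (suc t)) (λ xs → ⟦ suc (occurrences (suc (suc t)) xs) ≟ 2 ⟧)))
  where
  open SeriesSolver
  x′ : Series
  x′ = X (suc (suc t))

-- Partial sums of the pentagonal series over a bounded product

module Truncation (M : ℕ) where
  open TruncatedPentagonal (λ k m → FirstLarger.B k m) (λ k → FirstLarger.B-start k) (λ {k} → FirstLarger.B-suc k)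
  open SeriesSolver

  private
    B : ℕ → ℕ → Series
    B k m = FirstLarger.B k m

  sign : ℕ → Series
  sign k = constant (-1ℤ ^ k)

  pentagonalPartialSum : ℕ → Series
  pentagonalPartialSum zero    = 𝟙
  pentagonalPartialSum (suc k) = pentagonalPartialSum k
    ⊕ sign (suc k) ⊛ (X (triangular k ℕ.+ suc k ℕ.* suc k) ⊛ (𝟙 ⊕ X (suc k)))

  error : ℕ → Series
  error zero    = 𝟘
  error (suc k) = error k ⊕ sign (suc k) ⊛ remainder k M

  error-coeff : ∀ k {i} → i ≤ M → coeff (error k) i ≡ 0ℤ
  error-coeff zero    {i} _   = 𝟘-coeff i
  error-coeff (suc k) {i} i≤M = cong₂ ℤ._+_ (error-coeff k i≤M)
    (trans (Convolution.constant-scale (-1ℤ ^ suc k) (coeff (remainder k M)) i)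
      (trans (cong (ℤ._*_ (-1ℤ ^ suc k)) (X-⊛-< {suc k ℕ.* suc M} (X (triangular k) ⊛ p (suc k))
          (ℕ.≤-trans (s≤s i≤M) (ℕ.m≤m+n (suc M) (k ℕ.* suc M)))))
        (ℤ.*-zeroʳ (-1ℤ ^ suc k))))

  sign-suc : ∀ k → sign (suc k) ≈ ⊖ sign k
  sign-suc k = coeffwise λ { zero → ℤ.-1*i≡-i (-1ℤ ^ k) ; (suc n) → refl }

  -- For k = 0 nothing is required except that a part exists, so every nonempty partition counts.
  B₀ : ∀ m → B 0 m ≈ p m ⊕ ⊖ 𝟙
  B₀ zero    = by-combination (𝟙 · FirstLarger.B-start 0 ⊞ (⊖ 𝟙) · p-zero)
    (solve 2 (λ b P → b :- (P :- :1) := :1 :* (b :- con 0ℤ) :+ :- :1 :* (P :- :1)) ≈-refl (B 0 0) (p 0))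
  B₀ (suc m) = fixpoint-unique m
    (by-combination (𝟙 · FirstLarger.B-suc 0 {m} z≤n ⊞ 𝟙 · B₀ m ⊞ X (1 ℕ.* suc m) · unit
        ⊞ 𝟙 · ≈-reflexive (cong X (ℕ.*-identityˡ (suc m))))
      (solve 6 (λ b b′ P x y e → b′ :- ((P :- :1 :+ x) :+ x :* b′) :=
          :1 :* (b′ :- (b :+ y :* e :+ x :* b′)) :+ (:1 :* (b :- (P :- :1)) :+ (y :* (e :- :1) :+ :1 :* (y :- x))))
        ≈-refl (B 0 m) (B 0 (suc m)) (p m) (X (suc m)) (X (1 ℕ.* suc m)) (X 0 ⊛ p 0)))
    (by-combination (𝟙 · p-suc m)
      (solve 3 (λ P P′ x → (P′ :- :1) :- ((P :- :1 :+ x) :+ x :* (P′ :- :1)) := :1 :* (P′ :- (P :+ x :* P′)))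
        ≈-refl (p m) (p (suc m)) (X (suc m))))
    where
    unit : X 0 ⊛ p 0 ≈ 𝟙
    unit = ≈-trans (⊛-cong X-zero p-zero) (⊛-identityˡ 𝟙)

  -- With alternating signs the identities `B-⊕-B` telescope, leaving the last `B k M` and the
  -- accumulated remainders.
  truncated : ∀ {k} → k ≤ M → pentagonalPartialSum k ⊛ p M ≈ 𝟙 ⊕ sign k ⊛ B k M ⊕ error k
  truncated {zero}  _   = by-combination ((⊖ 𝟙) · B₀ M)
    (solve 2 (λ P b → :1 :* P :- (:1 :+ :1 :* b :+ con 0ℤ) := :- :1 :* (b :- (P :- :1))) ≈-refl (p M) (B 0 M))
  truncated {suc k} k<M = by-combination
    (𝟙 · truncated (ℕ.<⇒≤ k<M) ⊞ (⊖ sign (suc k)) · step ⊞ B k M · sign-suc k)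
    (solve 9 (λ s P σ σ′ t b b′ e r →
        (s :+ σ′ :* t) :* P :- (:1 :+ σ′ :* b′ :+ (e :+ σ′ :* r)) :=
        :1 :* (s :* P :- (:1 :+ σ :* b :+ e)) :+ (:- σ′ :* (b′ :+ b :+ r :- t :* P) :+ b :* (σ′ :- :- σ)))
      ≈-refl (pentagonalPartialSum k) (p M) (sign k) (sign (suc k)) (X (triangular k ℕ.+ suc k ℕ.* suc k) ⊛ (𝟙 ⊕ X (suc k)))
        (B k M) (B (suc k) M) (error k) (remainder k M))
    where
    step : B (suc k) M ⊕ B k M ⊕ remainder k M ≈ X (triangular k ℕ.+ suc k ℕ.* suc k) ⊛ (𝟙 ⊕ X (suc k)) ⊛ p M
    step = subst (λ m → B (suc k) m ⊕ B k m ⊕ remainder k m ≈ X (triangular k ℕ.+ suc k ℕ.* suc k) ⊛ (𝟙 ⊕ X (suc k)) ⊛ p m)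
      (trans (sym (ℕ.+-suc (M ∸ suc k) k)) (ℕ.m∸n+n≡m k<M)) (B-⊕-B k (M ∸ suc k))

-- Finite sums and the symmetric range

sumTo : ℕ → (ℕ → ℤ) → ℤ
sumTo zero    f = 0ℤ
sumTo (suc n) f = f 0 ℤ.+ sumTo n (f ∘ suc)

sumTo-cong : ∀ n {f g} → (∀ i → f i ≡ g i) → sumTo n f ≡ sumTo n g
sumTo-cong zero    h = refl
sumTo-cong (suc n) h = cong₂ ℤ._+_ (h 0) (sumTo-cong n (h ∘ suc))

sumTo-last : ∀ n f → sumTo (suc n) f ≡ sumTo n f ℤ.+ f n
sumTo-last zero    f = ℤ.+-comm (f 0) 0ℤ
sumTo-last (suc n) f = trans (cong (ℤ._+_ (f 0)) (sumTo-last n (f ∘ suc))) (sym (ℤ.+-assoc (f 0) _ _))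

∑-applyUpTo : ∀ n (g : ℕ → ℕ) f → ∑ (applyUpTo g n) f ≡ sumTo n (f ∘ g)
∑-applyUpTo zero    g f = refl
∑-applyUpTo (suc n) g f = cong (ℤ._+_ (f (g 0))) (∑-applyUpTo n (g ∘ suc) f)

∑-map : ∀ {A B : Set} (h : A → B) xs f → ∑ (map h xs) f ≡ ∑ xs (f ∘ h)
∑-map h []       f = refl
∑-map h (x ∷ xs) f = cong (ℤ._+_ (f (h x))) (∑-map h xs f)

convolve-sumTo : ∀ f g n → convolve f g n ≡ sumTo (suc n) (λ j → f j * g (n ∸ j))
convolve-sumTo f g zero    = sym (ℤ.+-identityʳ _)
convolve-sumTo f g (suc n) = cong (ℤ._+_ (f 0 * g (suc n))) (convolve-sumTo (f ∘ suc) g n)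

∑-symmetricRange-suc : ∀ k (F : ℤ → ℤ) → ∑ (symmetricRange (suc k)) F ≡ F -[1+ k ] ℤ.+ (∑ (symmetricRange k) F ℤ.+ F (+ suc k))
∑-symmetricRange-suc k F = begin
  ∑ (symmetricRange (suc k)) F
    ≡⟨ range (suc k) ⟩
  sumTo (suc (2 ℕ.* suc k)) (λ i → F (+ i - + suc k))
    ≡⟨ cong (λ N → sumTo (suc N) (λ i → F (+ i - + suc k))) (ℕ.*-suc 2 k) ⟩
  F -[1+ k ] ℤ.+ sumTo (suc (suc (2 ℕ.* k))) (λ i → F (+ suc i - + suc k))
    ≡⟨ cong (ℤ._+_ (F -[1+ k ])) (sumTo-last (suc (2 ℕ.* k)) (λ i → F (+ suc i - + suc k))) ⟩
  F -[1+ k ] ℤ.+ (sumTo (suc (2 ℕ.* k)) (λ i → F (+ suc i - + suc k)) ℤ.+ F (+ suc (suc (2 ℕ.* k)) - + suc k))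
    ≡⟨ cong (ℤ._+_ (F -[1+ k ])) (cong₂ ℤ._+_ (trans (sumTo-cong (suc (2 ℕ.* k)) shift) (sym (range k))) (cong F last)) ⟩
  F -[1+ k ] ℤ.+ (∑ (symmetricRange k) F ℤ.+ F (+ suc k)) ∎
  where
  open ≡-Reasoning
  range : ∀ k → ∑ (symmetricRange k) F ≡ sumTo (suc (2 ℕ.* k)) (λ i → F (+ i - + k))
  range k = trans (∑-map (λ i → + i - + k) (upTo (suc (2 ℕ.* k))) F) (∑-applyUpTo (suc (2 ℕ.* k)) id (λ i → F (+ i - + k)))
  shift : ∀ i → F (+ suc i - + suc k) ≡ F (+ i - + k)
  shift i = cong F (trans (ℤ.[1+m]⊖[1+n]≡m⊖n i k) (sym (ℤ.m-n≡m⊖n i k)))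
  last : + suc (suc (2 ℕ.* k)) - + suc k ≡ + suc k
  last = trans (ℤ.⊖-≥ {suc (suc (2 ℕ.* k))} {suc k} (s≤s (ℕ.m≤n⇒m≤1+n (ℕ.m≤m+n k _))))
    (cong +_ (trans
      (cong (_∸ k) (trans (sym (ℕ.+-suc k (k ℕ.+ 0))) (cong (λ i → k ℕ.+ suc i) (ℕ.+-identityʳ k))))
      (ℕ.m+n∸m≡n k (suc k))))

-- Pentagonal numbers

triangular-double : ∀ k → triangular k ℕ.* 2 ≡ k ℕ.* suc k
triangular-double zero    = refl
triangular-double (suc k) = trans (ℕ.*-distribʳ-+ 2 (suc k) (triangular k))
  (trans (cong (suc k ℕ.* 2 ℕ.+_) (triangular-double k))
    (solve 1 (λ k → (con 1 :+ k) :* con 2 :+ k :* (con 1 :+ k) := (con 1 :+ k) :* (con 2 :+ k)) refl k))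
  where open Data.Nat.Solver.+-*-Solver

half : ∀ {i} N → i ≡ + (N ℕ.* 2) → i ℤ./ + 2 ≡ + N
half N refl = trans (ℤ.*-identityˡ _) (cong +_ (ℕ.m*n/n≡m N 2))

double : ∀ k → + ((triangular k ℕ.+ suc k ℕ.* suc k) ℕ.* 2) ≡ + k * + suc k ℤ.+ + suc k * + suc k * + 2
double k = begin
  + ((triangular k ℕ.+ suc k ℕ.* suc k) ℕ.* 2)               ≡⟨ cong +_ (ℕ.*-distribʳ-+ 2 (triangular k) (suc k ℕ.* suc k)) ⟩
  + (triangular k ℕ.* 2 ℕ.+ suc k ℕ.* suc k ℕ.* 2)           ≡⟨ cong (λ t → + (t ℕ.+ suc k ℕ.* suc k ℕ.* 2)) (triangular-double k) ⟩
  + (k ℕ.* suc k ℕ.+ suc k ℕ.* suc k ℕ.* 2)                  ≡⟨ ℤ.pos-+ (k ℕ.* suc k) _ ⟩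
  + (k ℕ.* suc k) ℤ.+ + (suc k ℕ.* suc k ℕ.* 2)
    ≡⟨ cong₂ ℤ._+_ (ℤ.pos-* k (suc k)) (trans (ℤ.pos-* (suc k ℕ.* suc k) 2) (cong (_* + 2) (ℤ.pos-* (suc k) (suc k)))) ⟩
  + k * + suc k ℤ.+ + suc k * + suc k * + 2                  ∎
  where open ≡-Reasoning

pentagonal-positive : ∀ k → pentagonal (+ suc k) ≡ + (triangular k ℕ.+ suc k ℕ.* suc k)
pentagonal-positive k = half (triangular k ℕ.+ suc k ℕ.* suc k) (sym (trans (double k)
  (solve 1 (λ k → let s = con 1ℤ :+ k in k :* s :+ s :* s :* con (+ 2) := s :* (con (+ 3) :* s :- con 1ℤ)) refl (+ k))))
  where open +-*-Solver

pentagonal-negative : ∀ k → pentagonal -[1+ k ] ≡ + ((triangular k ℕ.+ suc k ℕ.* suc k) ℕ.+ suc k)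
pentagonal-negative k = half ((triangular k ℕ.+ suc k ℕ.* suc k) ℕ.+ suc k) (sym (trans
  (cong +_ (ℕ.*-distribʳ-+ 2 (triangular k ℕ.+ suc k ℕ.* suc k) (suc k)))
  (trans (cong₂ ℤ._+_ (double k) (ℤ.pos-* (suc k) 2))
    (solve 1 (λ k → let s = con 1ℤ :+ k in
      k :* s :+ s :* s :* con (+ 2) :+ s :* con (+ 2) := (:- s) :* (con (+ 3) :* (:- s) :- con 1ℤ)) refl (+ k)))))
  where open +-*-Solver

-- Coefficients of the unimodal series and of the crank series

U : ℕ → Series
coeff (U m) n = + u m n

-- The value 0 at negative arguments is the vanishing of q^a times a series below order `a`.
uℤ-shift : ∀ m n a → + uℤ m (+ n - + a) ≡ coeff (X a ⊛ U m) n
uℤ-shift m n a with a ≤? n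
... | yes a≤n = trans (cong (λ i → + uℤ m i) (trans (ℤ.m-n≡m⊖n n a) (ℤ.⊖-≥ a≤n)))
  (trans (sym (X-⊛-shift a (U m) (n ∸ a))) (cong (coeff (X a ⊛ U m)) (ℕ.m+[n∸m]≡n a≤n)))
... | no  a≰n = trans (cong (λ i → + uℤ m i) (trans (ℤ.m-n≡m⊖n n a) (ℤ.⊖-< (ℕ.≰⇒> a≰n))))
  (trans (negative (ℕ.m<n⇒0<n∸m (ℕ.≰⇒> a≰n))) (sym (X-⊛-< (U m) (ℕ.≰⇒> a≰n))))
  where
  negative : ∀ {d} → 0 < d → + uℤ m (ℤ.- + d) ≡ 0ℤ
  negative (s≤s _) = refl

∑-pentagonal : ∀ M m n k → ∑ (symmetricRange k) (λ j → sgn j * + uℤ m (+ n - pentagonal j))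
                           ≡ coeff (Truncation.pentagonalPartialSum M k ⊛ U m) n
∑-pentagonal M m n zero    = trans (ℤ.+-identityʳ _) (trans (ℤ.*-identityˡ _)
  (trans (uℤ-shift m n 0) (at (⊛-congʳ {U m} X-zero) n)))
∑-pentagonal M m n (suc k) = begin
  ∑ (symmetricRange (suc k)) F
    ≡⟨ ∑-symmetricRange-suc k F ⟩
  F -[1+ k ] ℤ.+ (∑ (symmetricRange k) F ℤ.+ F (+ suc k))
    ≡⟨ cong₂ ℤ._+_ (term (pentagonal-negative k)) (cong₂ ℤ._+_ (∑-pentagonal M m n k) (term (pentagonal-positive k))) ⟩
  σ * coeff (X (a ℕ.+ suc k) ⊛ U m) n ℤ.+ (coeff (S ⊛ U m) n ℤ.+ σ * coeff (X a ⊛ U m) n)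
    ≡⟨ cong₂ (λ x y → x ℤ.+ (coeff (S ⊛ U m) n ℤ.+ y))
         (Convolution.constant-scale σ (coeff (X (a ℕ.+ suc k) ⊛ U m)) n)
         (Convolution.constant-scale σ (coeff (X a ⊛ U m)) n) ⟨
  coeff (sign (suc k) ⊛ (X (a ℕ.+ suc k) ⊛ U m) ⊕ (S ⊛ U m ⊕ sign (suc k) ⊛ (X a ⊛ U m))) n
    ≡⟨ at (by-combination ((sign (suc k) ⊛ U m) · X-+ a (suc k))
         (solve 6 (λ c xs x s P v →
             c :* (xs :* v) :+ (P :* v :+ c :* (x :* v)) :- (P :+ c :* (x :* (:1 :+ s))) :* v := c :* v :* (xs :- x :* s))
           ≈-refl (sign (suc k)) (X (a ℕ.+ suc k)) (X a) (X (suc k)) S (U m))) n ⟩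
  coeff (pentagonalPartialSum (suc k) ⊛ U m) n ∎
  where
  open ≡-Reasoning
  open SeriesSolver
  open Truncation M
  F : ℤ → ℤ
  F j = sgn j * + uℤ m (+ n - pentagonal j)
  σ = -1ℤ ^ suc k
  a = triangular k ℕ.+ suc k ℕ.* suc k
  S = pentagonalPartialSum k
  term : ∀ {i a} → i ≡ + a → σ * + uℤ m (+ n - i) ≡ σ * coeff (X a ⊛ U m) n
  term {a = a} refl = cong (σ *_) (uℤ-shift m n a)

crankSeries : ℕ → Fin 3 → Series
crankSeries M 0F = X 1 ⊛ K M 1
crankSeries M 1F = K M 0
crankSeries M 2F = K M 0 ⊕ ⊖ (X 1 ⊛ K M 1)

C-crankSeries : ∀ {n} M m → n ≤ suc M → C m n ≡ coeff (crankSeries M m) n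
C-crankSeries     M 0F n≤ = C₀≡ M n≤
C-crankSeries     M 1F n≤ = C₁≡ M n≤
C-crankSeries {n} M 2F n≤ = trans (C₂≡C₁-C₀ n) (cong₂ _-_ (C₁≡ M n≤) (C₀≡ M n≤))

u₀-crankSeries : ∀ {n} M → n ≤ suc M → + u 0 n ≡ coeff (X 1 ⊛ K M 1 ⊛ p M) n
u₀-crankSeries {n} M n≤ = trans (u₀-V n≤) (at (≈-trans (V₀≈L M)
  (≈-trans (⊛-congˡ {X 1} (L≈K⊛p M 1)) (≈-sym (⊛-assoc (X 1) (K M 1) (p M))))) n)

-- This is U_m = C_m/(q)_∞ cut off at `M`. For m = 1, 2 the compositions have size n + m, and
-- dividing by q^m returns to `n`; m = 2 reaches n + 2, which is why the bound is `suc n ≤ M`.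
u-crankSeries : ∀ {n} M m → suc n ≤ M → + u (toℕ m) n ≡ coeff (crankSeries M m ⊛ p M) n
u-crankSeries     M 0F n<M = u₀-crankSeries M (ℕ.m≤n⇒m≤1+n (ℕ.<⇒≤ n<M))
u-crankSeries {n} M 1F n<M = begin
  + u 1 n                                     ≡⟨ u-V 0 {M = suc M} (ℕ.≤-trans (ℕ.≤-reflexive (ℕ.+-comm n 1)) (ℕ.m≤n⇒m≤1+n n<M)) ⟩
  coeff (Multiplicity.V 1 (suc M)) (n ℕ.+ 1)  ≡⟨ cong (coeff (Multiplicity.V 1 (suc M))) (ℕ.+-comm n 1) ⟩
  coeff (Multiplicity.V 1 (suc M)) (1 ℕ.+ n)  ≡⟨ at (V₁≈L M) (1 ℕ.+ n) ⟩
  coeff (X 1 ⊛ L M 0) (1 ℕ.+ n)               ≡⟨ X-⊛-shift 1 (L M 0) n ⟩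
  coeff (L M 0) n                             ≡⟨ at (L≈K⊛p M 0) n ⟩
  coeff (K M 0 ⊛ p M) n                       ∎
  where open ≡-Reasoning
u-crankSeries {n} M 2F n<M = begin
  + u 2 n                                     ≡⟨ u-V 1 {M = suc M} (ℕ.≤-trans (ℕ.≤-reflexive (ℕ.+-comm n 2)) (s≤s n<M)) ⟩
  coeff (Multiplicity.V 2 (suc M)) (n ℕ.+ 2)  ≡⟨ cong (coeff (Multiplicity.V 2 (suc M))) (ℕ.+-comm n 2) ⟩
  coeff (Multiplicity.V 2 (suc M)) (2 ℕ.+ n)  ≡⟨ at (V₂≈ M) (2 ℕ.+ n) ⟩
  coeff (X 2 ⊛ (L M 0 ⊕ ⊖ AnyMultiplicity.V M)) (2 ℕ.+ n)
    ≡⟨ X-⊛-shift 2 (L M 0 ⊕ ⊖ AnyMultiplicity.V M) n ⟩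
  coeff (L M 0) n - coeff (AnyMultiplicity.V M) n
    ≡⟨ cong₂ _-_ (at (L≈K⊛p M 0) n)
         (trans (sym (u₀-V (ℕ.<⇒≤ n<M))) (u₀-crankSeries M (ℕ.m≤n⇒m≤1+n (ℕ.<⇒≤ n<M)))) ⟩
  coeff (K M 0 ⊛ p M ⊕ ⊖ (X 1 ⊛ K M 1 ⊛ p M)) n
    ≡⟨ at (solve 3 (λ a b c → a :* c :- b :* c := (a :- b) :* c) ≈-refl (K M 0) (X 1 ⊛ K M 1) (p M)) n ⟩
  coeff ((K M 0 ⊕ ⊖ (X 1 ⊛ K M 1)) ⊛ p M) n   ∎
  where
  open ≡-Reasoning
  open SeriesSolver

-- Multiplying the truncated identity by the crank series

⊛-exchange : ∀ f g h → f ⊛ (g ⊛ h) ≈ g ⊛ (f ⊛ h)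
⊛-exchange = solve 3 (λ f g h → f :* (g :* h) := g :* (f :* h)) ≈-refl
  where open SeriesSolver

⊛-distrib-𝟙⊕ : ∀ f s g → f ⊛ (𝟙 ⊕ s ⊛ g) ≈ f ⊕ s ⊛ (f ⊛ g)
⊛-distrib-𝟙⊕ = solve 3 (λ f s g → f :* (:1 :+ s :* g) := f :+ s :* (f :* g)) ≈-refl
  where open SeriesSolver

-1^-square : ∀ k → -1ℤ ^ k * -1ℤ ^ k ≡ 1ℤ
-1^-square zero    = refl
-1^-square (suc k) = trans (solve 1 (λ s → (con -1ℤ :* s) :* (con -1ℤ :* s) := s :* s) refl (-1ℤ ^ k)) (-1^-square k)
  where open +-*-Solver

theorem1p4 : ∀ (k n : ℕ) .{{_ : NonZero k}} .{{_ : NonZero n}} (m : Fin 3) →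
    -1ℤ ^ (k ∸ 1) * (C m n - ∑ (symmetricRange k) (λ j → sgn j * + uℤ (toℕ m) (+ n - pentagonal j)))
    ≡ ∑ (upTo (suc n)) (λ j → C m j * + P̃ k (n ∸ j))
theorem1p4 zero        n m = contradiction refl (ℕ.≢-nonZero⁻¹ 0)
theorem1p4 k@(suc k-1) n m = begin
  -1ℤ ^ k-1 * (C m n - ∑ (symmetricRange k) (λ j → sgn j * + uℤ (toℕ m) (+ n - pentagonal j)))
    ≡⟨ cong₂ (λ x y → -1ℤ ^ k-1 * (x - y)) (C-crankSeries M m (n≤1+M ℕ.≤-refl)) lhs ⟩
  -1ℤ ^ k-1 * (coeff c n - (coeff c n ℤ.+ -1ℤ ^ k * T))
    ≡⟨ solve 3 (λ s x t → s :* (x :- (x :+ con -1ℤ :* s :* t)) := s :* s :* t) refl (-1ℤ ^ k-1) (coeff c n) T ⟩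
  -1ℤ ^ k-1 * -1ℤ ^ k-1 * T
    ≡⟨ trans (cong (_* T) (-1^-square k-1)) (ℤ.*-identityˡ T) ⟩
  T
    ≡⟨ convolve-cong-≤ n (λ i i≤n → sym (C-crankSeries M m (n≤1+M i≤n))) (λ i i≤n → sym (P̃≡ k (n≤M i≤n))) ⟩
  convolve (C m) (λ i → + P̃ k i) n
    ≡⟨ trans (convolve-sumTo (C m) (λ i → + P̃ k i) n) (sym (∑-applyUpTo (suc n) id (λ j → C m j * + P̃ k (n ∸ j)))) ⟩
  ∑ (upTo (suc n)) (λ j → C m j * + P̃ k (n ∸ j)) ∎
  where
  open ≡-Reasoning
  open +-*-Solver
  -- Large enough for k ≤ M in `truncated` and for i + 1 ≤ M, with i ≤ n, in `u-crankSeries`.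
  M : ℕ
  M = suc n ℕ.+ k
  open Truncation M using (pentagonalPartialSum; sign; error; error-coeff; truncated)
  n≤M : ∀ {i} → i ≤ n → i ≤ M
  n≤M i≤n = ℕ.m≤n⇒m≤1+n (ℕ.≤-trans i≤n (ℕ.m≤m+n n k))
  n≤1+M : ∀ {i} → i ≤ n → i ≤ suc M
  n≤1+M i≤n = ℕ.m≤n⇒m≤1+n (n≤M i≤n)
  c S B : Series
  c = crankSeries M m
  S = pentagonalPartialSum k
  B = FirstLarger.B k M
  T : ℤ
  T = coeff (c ⊛ B) n
  lhs : ∑ (symmetricRange k) (λ j → sgn j * + uℤ (toℕ m) (+ n - pentagonal j)) ≡ coeff c n ℤ.+ -1ℤ ^ k * T
  lhs = begin
    ∑ (symmetricRange k) (λ j → sgn j * + uℤ (toℕ m) (+ n - pentagonal j))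
      ≡⟨ ∑-pentagonal M (toℕ m) n k ⟩
    coeff (S ⊛ U (toℕ m)) n
      ≡⟨ convolve-cong-≤ n (λ _ _ → refl) (λ i i≤n → u-crankSeries M m (s≤s (ℕ.≤-trans i≤n (ℕ.m≤m+n n k)))) ⟩
    coeff (S ⊛ (c ⊛ p M)) n
      ≡⟨ at (⊛-exchange S c (p M)) n ⟩
    coeff (c ⊛ (S ⊛ p M)) n
      ≡⟨ at (⊛-congˡ {c} (truncated (ℕ.m≤n+m k (suc n)))) n ⟩
    coeff (c ⊛ (𝟙 ⊕ sign k ⊛ B ⊕ error k)) n
      ≡⟨ convolve-cong-≤ {g′ = coeff (𝟙 ⊕ sign k ⊛ B)} n (λ _ _ → refl)
           (λ i i≤n → trans (cong (ℤ._+_ (coeff (𝟙 ⊕ sign k ⊛ B) i)) (error-coeff k (n≤M i≤n))) (ℤ.+-identityʳ _)) ⟩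
    coeff (c ⊛ (𝟙 ⊕ sign k ⊛ B)) n
      ≡⟨ at (⊛-distrib-𝟙⊕ c (sign k) B) n ⟩
    coeff c n ℤ.+ coeff (sign k ⊛ (c ⊛ B)) n
      ≡⟨ cong (ℤ._+_ (coeff c n)) (Convolution.constant-scale (-1ℤ ^ k) (coeff (c ⊛ B)) n) ⟩
    coeff c n ℤ.+ -1ℤ ^ k * T ∎
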